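{- Let $k\geq 2$ and $n\ge 1$. For every integer $m\ge 2$ let $$N_m=\frac1m\sum_{d\mid m,\ d\neq m}\mu(d)\left(2^{m/d}-2\right),$$ and let $\mathcal{D}_k$ be the set of positive divisors of $k$ other than $1$. Then the number of Grassmanian permutations $\pi\in\mathcal{S}_n$ with $\pi(1)\neq1$, $\pi(n)\neq n$ and $\pi^k=\mathrm{id}$ equals the number of solutions in non-negative integers $(x_{d,i})_{d\in\mathcal{D}_k,\,1\le i\le N_d}$ of the linear equation $$\sum_{d\in\mathcal{D}_k} d\cdot\sum_{i=1}^{N_d}x_{d,i}=n.$$ In particular, for a prime $p\ge 2$, $N_p=\frac1p(2^p-2)$, and the number of Grassmanian permutations $\pi\in\mathcal{S}_n$ with $\pi(1)\neq1$, $\pi(n)\neq n$ and $\pi^p=\mathrm{id}$ is $\binom{n/p+N_p-1}{N_p-1}$ if $p\mid n$, and $0$ otherwise.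
   Context: $\mathcal{S}_n$ is the symmetric group on $[n]=\{1,\dots,n\}$. For $\pi\in\mathcal{S}_n$, $\operatorname{des}(\pi)$ is the number of indices $i\in[n-1]$ with $\pi(i)>\pi(i+1)$; $\pi$ is Grassmanian if $\operatorname{des}(\pi)\le1$. $\mu$ is the Möbius function and $\mathrm{id}$ is the identity permutation. -}

module Defs where

import Data.Nat
open import Data.Nat using (ℕ; zero; suc; _+_; _*_; _∸_; _^_; _<_; _≤_; _<?_)
open import Data.Nat.Divisibility using (_∣_; _∣?_)
open import Data.Nat.Primality using (Prime; prime?)
import Data.Nat.DivMod as ℕD
open import Data.Integer as ℤ using (ℤ; +_; ∣_∣)
open import Data.Fin as Fin using (Fin; toℕ)
open import Data.Fin.Properties using (all?; _≟_)
open import Data.Vec as Vec using (Vec; []; _∷_; lookup; toList)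
open import Data.List as List using (List; []; _∷_; length; filter; map; concatMap; replicate; upTo; zipWith; allFin)
open import Data.Nat.ListAction using (sum)
open import Data.List.Relation.Unary.Unique.Propositional using (Unique)
import Data.List.Relation.Unary.Unique.DecPropositional as UDec
open import Data.Product using (Σ; Σ-syntax; _×_)
open import Relation.Nullary using (Dec; ¬_; _×-dec_; ¬?)
open import Relation.Binary.PropositionalEquality using (_≡_)
open import Function using (_∘_)
open import Data.Bool using (if_then_else_)

primesUpTo : ℕ → List ℕ
primesUpTo d = filter prime? (map suc (upTo d))

μ : ℕ → ℤ
μ zero = + 0
μ d@(suc _) with length (filter (λ p → (p * p) ∣? d) (primesUpTo d))
... | suc _ = + 0
... | zero  = (ℤ.- (+ 1)) ℤ.^ length (filter (λ p → p ∣? d) (primesUpTo d))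

properDivisors : ℕ → List ℕ
properDivisors m = filter (λ d → (d ∣? m) ×-dec (d <? m)) (map suc (upTo m))

-- natural-number division m / d (only ever used with d ≥ 1; m / 0 := 0)
_div_ : ℕ → ℕ → ℕ
m div zero    = 0
m div (suc e) = ℕD._/_ m (suc e)

Nsum : ℕ → ℤ
Nsum m = List.foldr ℤ._+_ (+ 0)
  (map (λ d → μ d ℤ.* ((+ (2 ^ (m div d))) ℤ.- (+ 2))) (properDivisors m))

-- N_m = Nsum m / m  (for m ≥ 2 the sum is a nonnegative multiple of m,
-- so this is exact)
N : ℕ → ℕ
N m = ∣ Nsum m ∣ div m

Dk : ℕ → List ℕ
Dk k = filter (λ d → (d ∣? k) ×-dec ¬? (d Data.Nat.≟ 1)) (map suc (upTo k))

-- the variables x_{d,i} (d ∈ D_k, 1 ≤ i ≤ N_d), listed with their weights d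
weights : ℕ → List ℕ
weights k = concatMap (λ d → replicate (N d) d) (Dk k)

weightedSum : List ℕ → List ℕ → ℕ
weightedSum ws xs = sum (zipWith _*_ ws xs)

Solutions : ℕ → ℕ → Set
Solutions k n = Σ[ x ∈ Vec ℕ (length (weights k)) ] weightedSum (weights k) (toList x) ≡ n

-- Permutations of [n] in one-line notation: π = (π(1), …, π(n)) with
-- entries in Fin n (0-based) and no repeated entry.

words : (n m : ℕ) → List (Vec (Fin n) m)
words n zero    = Vec.[] ∷ []
words n (suc m) = concatMap (λ a → map (a Vec.∷_) (words n m)) (allFin n)

IsPerm : ∀ {n} → Vec (Fin n) n → Set
IsPerm π = Unique (toList π)

desL : ∀ {n} → List (Fin n) → ℕ
desL [] = 0
desL (a ∷ rest) = go a rest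
  where
  go : _ → List _ → ℕ
  go a [] = 0
  go a (b ∷ rest) = (if toℕ b Data.Nat.<ᵇ toℕ a then 1 else 0) + go b rest

des : ∀ {n} → Vec (Fin n) n → ℕ
des π = desL (toList π)

Grassmannian : ∀ {n} → Vec (Fin n) n → Set
Grassmannian π = des π ≤ 1

pow : ∀ {n} → Vec (Fin n) n → ℕ → Fin n → Fin n
pow π zero    i = i
pow π (suc k) i = lookup π (pow π k i)

PowId : ∀ {n} → ℕ → Vec (Fin n) n → Set
PowId k π = ∀ i → pow π k i ≡ i

Good : (k m : ℕ) → Vec (Fin (suc m)) (suc m) → Set
Good k m π = IsPerm π × Grassmannian π
  × (¬ lookup π Fin.zero ≡ Fin.zero)
  × (¬ lookup π (Fin.fromℕ m) ≡ Fin.fromℕ m)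
  × PowId k π

good? : (k m : ℕ) → (π : Vec (Fin (suc m)) (suc m)) → Dec (Good k m π)
good? k m π = UDec.unique? (_≟_ {suc m}) (toList π) ×-dec (des π Data.Nat.≤? 1)
  ×-dec ¬? (lookup π Fin.zero ≟ Fin.zero)
  ×-dec ¬? (lookup π (Fin.fromℕ m) ≟ Fin.fromℕ m)
  ×-dec all? {suc m} (λ i → pow π k i ≟ i)

countGood : (k m : ℕ) → ℕ
countGood k m = length (filter (good? k m) (words (suc m) (suc m)))

{-# OPTIONS --safe #-}
-- Gessel–Reutenauer for two runs.  A Grassmannian permutation π with π(1) ≠ 1 and π(n) ≠ n has no fixed point,
-- and its two runs are { i : π(i) > i } and { i : π(i) < i }.  Labelling the runs 0 and 1, the labels met along
-- i, π(i), …, π^(k-1)(i) form a nonconstant binary word of length k.  Read as a number x(i) in 1, …, 2^k - 2 it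
-- satisfies x(π(i)) = 2 x(i) mod 2^k - 1, and x is weakly increasing, so x is determined by how often it takes
-- each value; these multiplicities are constant on the orbits of doubling mod 2^k - 1.  Conversely, given such
-- multiplicities with sum n, sort the values into a sequence x: π is the standardization of i ↦ 2 x(i).
-- Doubling^d has 2^d - 2 fixed points for d ∣ k, so by Möbius inversion it has N_d orbits of size d, and an
-- orbit-constant multiplicity function with sum n is a solution of the linear equation.
module Submission where

open import Defs

open import Algebra.Bundles using (CommutativeMonoid)
open import Data.Empty using (⊥-elim)
open import Data.Fin as Fin using (Fin; zero; suc; toℕ; fromℕ<)
import Data.Fin.Induction as FinInd
import Data.Fin.Permutation as Perm
import Data.Fin.Properties as Finₚ
import Data.Integer as ℤ
open import Data.Integer using (ℤ) renaming (+_ to ⁺_)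
import Data.Integer.Properties as ℤₚ
open import Data.List as List using (List; []; _∷_; _++_; length; filter; map; concatMap; replicate; allFin)
open import Data.List.Membership.Propositional using (_∈_)
import Data.List.Membership.Propositional.Properties as ∈ₚ
import Data.List.Properties as Listₚ
open import Data.List.Relation.Unary.All as All using (All; []; _∷_)
import Data.List.Relation.Unary.All.Properties as Allₚ
open import Data.List.Relation.Unary.Any as Any using (here; there)
import Data.List.Relation.Unary.Any.Properties as Anyₚ
open import Data.List.Relation.Unary.Unique.Propositional using (Unique; []; _∷_)
import Data.List.Relation.Unary.Unique.Propositional.Properties as Uniqueₚ
import Data.Nat as ℕ
open import Data.Nat using (ℕ; zero; suc; _+_; _*_; _∸_; _^_; _≤_; _<_; z≤n; s≤s; _<?_; _≤?_; NonZero)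
open import Data.Nat.Combinatorics using (_C_; nCn≡1; nCk+nC[k+1]≡[n+1]C[k+1])
open import Data.Nat.Divisibility
import Data.Nat.DivMod as DM
open import Data.Nat.ListAction using (product)
open import Data.Nat.Primality using (Prime; prime?; euclidsLemma; prime⇒nonZero; prime⇒irreducible; ¬prime[1])
open import Data.Nat.Primality.Factorisation using (factorise)
open import Data.Nat.Properties
open import Data.Nat.Tactic.RingSolver using (solve-∀)
open import Data.Product using (Σ-syntax; ∃; _×_; _,_; proj₁; proj₂)
open import Data.Sum using (_⊎_; inj₁; inj₂; [_,_]′)
open import Data.Sum.Function.Propositional using (_⊎-↔_)
open import Data.Vec as Vec using (Vec; []; _∷_; lookup; toList)
import Data.Vec.Properties as Vecₚ
open import Data.Bool using (if_then_else_)
open import Function using (_∘_; id)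
open import Function.Bundles using (_↔_; mk↔ₛ′)
open import Function.Properties.Inverse using (↔-sym; ↔-trans)
open import Induction.WellFounded using (Acc; acc)
open import Relation.Binary.Definitions using (tri<; tri≈; tri>)
open import Relation.Binary.PropositionalEquality using (_≡_; _≢_; refl; sym; trans; cong; cong₂; subst; subst₂; module ≡-Reasoning)
open import Relation.Nullary using (Dec; yes; no; does; ¬_; _×-dec_; _⊎-dec_; ¬?; contradiction)

import Algebra.Properties.Semiring.Sum ℤₚ.+-*-semiring as ℤ∑

-- Finite sums and counting

-- Multiplicities are constant on orbits because π maps the positions of value v bijectively onto
-- the positions of value 2 v. Read backwards, the same balance makes i ↦ 2 x(i) a rearrangement of
-- x, which is why its standardization satisfies x(π(i)) = 2 x(i). Breaking ties by position is
-- forced: equal values 2 x(i) come from equal values x(i), hence from positions in one run, and π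
-- increases on a run. The constant words cannot occur because a point whose label never changes
-- would start an endless monotone chain in a finite set. Doubling modulo 2^k - 1 is itself a map of
-- the same two-run shape, its upward part being the residues doubled without reduction. Since x is
-- sorted, π moves a position in the direction in which doubling moves its value, so the labels
-- along the orbit of i can be read off x(i) alone.

module SumOverImage {c ℓ} (M : CommutativeMonoid c ℓ) where
  open CommutativeMonoid M using (Carrier; _≈_; ∙-cong; ∙-congˡ)
    renaming (ε to 0#; refl to ≈-refl; sym to ≈-sym; trans to ≈-trans; reflexive to ≈-reflexive)
  open import Algebra.Properties.CommutativeMonoid.Sum M

  sum-zero : ∀ {n} (g : Fin n → Carrier) → (∀ v → g v ≈ 0#) → sum g ≈ 0#
  sum-zero {n} g z = ≈-trans (sum-cong-≋ z) (sum-replicate-zero n)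

  -- Extending a range, restricting to multiples and permuting the index are all instances. The
  -- induction deletes the point `e zero` from the codomain with `punchOut`, which leaves an
  -- injection `e′` from one point fewer.
  sum-image : ∀ {p n} (e : Fin p → Fin n) → (∀ {i j} → e i ≡ e j → i ≡ j) →
              (g : Fin n → Carrier) → (∀ v → (∀ j → e j ≢ v) → g v ≈ 0#) →
              sum (g ∘ e) ≈ sum g
  sum-image {zero}          e inj g z = ≈-sym (sum-zero g (λ v → z v (λ ())))
  sum-image {suc p} {zero}  e inj g z with () ← e zero
  sum-image {suc p} {suc n} e inj g z =
    ≈-trans (∙-congˡ (≈-trans
      (sum-cong-≋ (λ j → ≈-reflexive (cong g (sym (Finₚ.punchIn-punchOut (e0≢ j))))))
      (sum-image e′ inj′ (g ∘ Fin.punchIn (e zero)) z′)))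
      (≈-sym (sum-remove {i = e zero} g))
    where
    e0≢ : ∀ j → e zero ≢ e (suc j)
    e0≢ j eq with () ← inj eq
    e′ : Fin p → Fin n
    e′ j = Fin.punchOut (e0≢ j)
    inj′ : ∀ {i j} → e′ i ≡ e′ j → i ≡ j
    inj′ {i} {j} eq with refl ← inj (Finₚ.punchOut-injective (e0≢ i) (e0≢ j) eq) = refl
    z′ : ∀ v → (∀ j → e′ j ≢ v) → g (Fin.punchIn (e zero) v) ≈ 0#
    z′ v miss = z _ λ where
      zero    eq → Finₚ.punchInᵢ≢i (e zero) v (sym eq)
      (suc j) eq → miss j (trans (Finₚ.punchOut-cong (e zero) {i≢k = Finₚ.punchInᵢ≢i (e zero) v ∘ sym} eq)
                                 (Finₚ.punchOut-punchIn (e zero)))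

  sum-extend : ∀ {m n} → m ≤ n → (g : ℕ → Carrier) → (∀ e → m ≤ e → g e ≈ 0#) →
               sum {m} (g ∘ toℕ) ≈ sum {n} (g ∘ toℕ)
  sum-extend {m} {n} m≤n g z = ≈-trans
    (sum-cong-≋ (λ i → ≈-reflexive (cong g (sym (Finₚ.toℕ-inject≤ i m≤n)))))
    (sum-image (λ i → Fin.inject≤ i m≤n) (Finₚ.inject≤-injective m≤n m≤n _ _) (g ∘ toℕ)
      (λ v miss → z (toℕ v) (≮⇒≥ λ v<m → miss (fromℕ< v<m)
        (Finₚ.toℕ-injective (trans (Finₚ.toℕ-inject≤ _ m≤n) (Finₚ.toℕ-fromℕ< v<m))))))

  sum-multiples : ∀ p n → (g : ℕ → Carrier) → (∀ e → ¬ suc p ∣ e → g e ≈ 0#) →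
                  sum {n} (λ j → g (suc p * suc (toℕ j))) ≈ sum {suc p * n} (λ i → g (suc (toℕ i)))
  sum-multiples p n g z = ≈-trans
    (sum-cong-≋ (λ j → ≈-reflexive (cong g (sym (toℕ-multiple j)))))
    (sum-image multiple
      (λ {i} {j} eq → Finₚ.toℕ-injective (suc-injective (*-cancelˡ-≡ _ _ (suc p)
        (trans (sym (toℕ-multiple i)) (trans (cong (suc ∘ toℕ) eq) (toℕ-multiple j))))))
      (g ∘ suc ∘ toℕ) (λ v miss → z (suc (toℕ v)) (λ p∣v → missed v p∣v miss)))
    where
    multiple : Fin n → Fin (suc p * n)
    multiple j = fromℕ< (*-monoʳ-≤ (suc p) (Finₚ.toℕ<n j))
    toℕ-multiple : ∀ j → suc (toℕ (multiple j)) ≡ suc p * suc (toℕ j)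
    toℕ-multiple j = cong suc (Finₚ.toℕ-fromℕ< (*-monoʳ-≤ (suc p) (Finₚ.toℕ<n j)))
    missed : ∀ v → suc p ∣ suc (toℕ v) → ¬ (∀ j → multiple j ≢ v)
    missed v (divides (suc q) eq) miss = miss (fromℕ< q<n) (Finₚ.toℕ-injective (suc-injective
      (trans (toℕ-multiple (fromℕ< q<n)) (trans (cong (λ x → suc p * suc x) (Finₚ.toℕ-fromℕ< q<n)) v≡))))
      where
      v≡ : suc p * suc q ≡ suc (toℕ v)
      v≡ = trans (*-comm (suc p) (suc q)) (sym eq)
      q<n : q < n
      q<n = *-cancelˡ-≤ (suc p) (subst (_≤ suc p * n) (sym v≡) (Finₚ.toℕ<n v))

open import Algebra.Properties.Semiring.Sum +-*-semiring
open SumOverImage +-0-commutativeMonoid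

private variable
  P Q R : Set
  n L : ℕ

⟦_⟧ : Dec P → ℕ
⟦ d ⟧ = if does d then 1 else 0

⟦⟧-yes : (d : Dec P) → P → ⟦ d ⟧ ≡ 1
⟦⟧-yes (yes _) p = refl
⟦⟧-yes (no ¬p) p = contradiction p ¬p

⟦⟧-no : (d : Dec P) → ¬ P → ⟦ d ⟧ ≡ 0
⟦⟧-no (yes p) ¬p = contradiction p ¬p
⟦⟧-no (no _)  ¬p = refl

⟦⟧-mono : (d : Dec P) (d′ : Dec Q) → (P → Q) → ⟦ d ⟧ ≤ ⟦ d′ ⟧
⟦⟧-mono (no _)  d′ f = z≤n
⟦⟧-mono (yes p) d′ f = ≤-reflexive (sym (⟦⟧-yes d′ (f p)))

⟦⟧≤1 : (d : Dec P) → ⟦ d ⟧ ≤ 1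
⟦⟧≤1 (yes _) = ≤-refl
⟦⟧≤1 (no _)  = z≤n

⟦⟧-cong : (d : Dec P) (d′ : Dec Q) → (P → Q) → (Q → P) → ⟦ d ⟧ ≡ ⟦ d′ ⟧
⟦⟧-cong d d′ f g = ≤-antisym (⟦⟧-mono d d′ f) (⟦⟧-mono d′ d g)

⟦⟧-× : (d : Dec P) (d′ : Dec Q) → ⟦ d ×-dec d′ ⟧ ≡ ⟦ d ⟧ * ⟦ d′ ⟧
⟦⟧-× (yes _) (yes _) = refl
⟦⟧-× (yes _) (no _)  = refl
⟦⟧-× (no _)  d′      = refl

⟦⟧-⊎ : (d : Dec P) (d₁ : Dec Q) (d₂ : Dec R) → (P → Q ⊎ R) → (Q → P) → (R → P) → ¬ (Q × R) →
       ⟦ d ⟧ ≡ ⟦ d₁ ⟧ + ⟦ d₂ ⟧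
⟦⟧-⊎ d (yes q) (yes r) f g h x = contradiction (q , r) x
⟦⟧-⊎ d (yes q) (no _)  f g h x = ⟦⟧-yes d (g q)
⟦⟧-⊎ d (no _)  (yes r) f g h x = ⟦⟧-yes d (h r)
⟦⟧-⊎ d (no ¬q) (no ¬r) f g h x = ⟦⟧-no d (λ p → [ ¬q , ¬r ]′ (f p))

# : {P : Fin n → Set} → (∀ i → Dec (P i)) → ℕ
# P? = sum (λ i → ⟦ P? i ⟧)

sum-mono : (f g : Fin n → ℕ) → (∀ i → f i ≤ g i) → sum f ≤ sum g
sum-mono {zero}  f g le = z≤n
sum-mono {suc n} f g le = +-mono-≤ (le zero) (sum-mono (f ∘ suc) (g ∘ suc) (le ∘ suc))

module _ {P Q : Fin n → Set} (P? : ∀ i → Dec (P i)) (Q? : ∀ i → Dec (Q i)) where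

  #-mono : (∀ i → P i → Q i) → # P? ≤ # Q?
  #-mono f = sum-mono _ _ (λ i → ⟦⟧-mono (P? i) (Q? i) (f i))

  #-cong : (∀ i → P i → Q i) → (∀ i → Q i → P i) → # P? ≡ # Q?
  #-cong f g = sum-cong-≗ (λ i → ⟦⟧-cong (P? i) (Q? i) (f i) (g i))

  #-⊎ : {R : Fin n → Set} (R? : ∀ i → Dec (R i)) →
        (∀ i → R i → P i ⊎ Q i) → (∀ i → P i → R i) → (∀ i → Q i → R i) → (∀ i → ¬ (P i × Q i)) →
        # R? ≡ # P? + # Q?
  #-⊎ R? f g h x = trans (sum-cong-≗ (λ i → ⟦⟧-⊎ (R? i) (P? i) (Q? i) (f i) (g i) (h i) (x i)))
                         (∑-distrib-+ (λ i → ⟦ P? i ⟧) (λ i → ⟦ Q? i ⟧))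

sum-const : ∀ n c → sum {n} (λ _ → c) ≡ n * c
sum-const zero    c = refl
sum-const (suc n) c = cong (c +_) (sum-const n c)

#-none : {P : Fin n → Set} (P? : ∀ i → Dec (P i)) → (∀ i → ¬ P i) → # P? ≡ 0
#-none P? none = sum-zero _ (λ i → ⟦⟧-no (P? i) (none i))

#-all : {P : Fin n → Set} (P? : ∀ i → Dec (P i)) → (∀ i → P i) → # P? ≡ n
#-all {n} P? all = trans (sum-cong-≗ (λ i → ⟦⟧-yes (P? i) (all i))) (trans (sum-const n 1) (*-identityʳ n))

#-image : ∀ {p} {P : Fin n → Set} (P? : ∀ i → Dec (P i)) (e : Fin p → Fin n) →
          (∀ {i j} → e i ≡ e j → i ≡ j) → (∀ j → P (e j)) → (∀ v → P v → ∃ λ j → e j ≡ v) → # P? ≡ p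
#-image P? e inj P-e surj = trans
  (sym (sum-image e inj (λ v → ⟦ P? v ⟧) (λ v miss → ⟦⟧-no (P? v) (λ p → let (j , eq) = surj v p in miss j eq))))
  (#-all (P? ∘ e) P-e)

#-single : {P : Fin n → Set} (P? : ∀ i → Dec (P i)) (v : Fin n) → P v → (∀ u → P u → v ≡ u) → # P? ≡ 1
#-single P? v Pv uniq = #-image {p = 1} P? (λ _ → v) (λ { {zero} {zero} _ → refl }) (λ _ → Pv) (λ u p → zero , uniq u p)

#-< : {P Q : Fin n → Set} (P? : ∀ i → Dec (P i)) (Q? : ∀ i → Dec (Q i)) →
      (∀ i → P i → Q i) → (v : Fin n) → ¬ P v → Q v → # P? < # Q?
#-< {P = P} P? Q? f v ¬Pv Qv = begin-strict
  # P?                       <⟨ n<1+n _ ⟩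
  1 + # P?                   ≡⟨ cong (_+ # P?) (sym (#-single V? v refl (λ _ → id))) ⟩
  # V? + # P?                ≡⟨ sym (#-⊎ V? P? V∪P? (λ _ → id) (λ _ → inj₁) (λ _ → inj₂) (λ { i (refl , p) → ¬Pv p })) ⟩
  # V∪P?                     ≤⟨ #-mono V∪P? Q? (λ { i (inj₁ refl) → Qv ; i (inj₂ p) → f i p }) ⟩
  # Q?                       ∎
  where
  open ≤-Reasoning
  V? : ∀ i → Dec (v ≡ i)
  V? i = v Finₚ.≟ i
  V∪P? : ∀ i → Dec (v ≡ i ⊎ P i)
  V∪P? i = V? i ⊎-dec P? i

#-below : ∀ {c} → c ≤ n → # {n} (λ i → toℕ i <? c) ≡ c
#-below {n} {c} c≤n = #-image (λ i → toℕ i <? c) (λ j → Fin.inject≤ j c≤n) (Finₚ.inject≤-injective c≤n c≤n _ _)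
  (λ j → subst (_< c) (sym (Finₚ.toℕ-inject≤ j c≤n)) (Finₚ.toℕ<n j))
  (λ v v<c → fromℕ< v<c , Finₚ.toℕ-injective (trans (Finₚ.toℕ-inject≤ _ c≤n) (Finₚ.toℕ-fromℕ< v<c)))

-- Double counting. It serves three times: to group points by orbit representative, to weigh a
-- solution by orbit sizes, and to count positions by their value.
sum-fibres : ∀ {r} (h : Fin L → Fin r) (f : Fin r → ℕ) → sum (f ∘ h) ≡ sum (λ i → # (λ v → h v Finₚ.≟ i) * f i)
sum-fibres h f = begin
  sum (λ v → f (h v))                                   ≡⟨ sum-cong-≗ (λ v → sym (expand v)) ⟩
  sum (λ v → sum (λ i → ⟦ h v Finₚ.≟ i ⟧ * f i))        ≡⟨ ∑-comm (λ v i → ⟦ h v Finₚ.≟ i ⟧ * f i) ⟩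
  sum (λ i → sum (λ v → ⟦ h v Finₚ.≟ i ⟧ * f i))        ≡⟨ sum-cong-≗ (λ i → sym (*-distribʳ-sum (f i) (λ v → ⟦ h v Finₚ.≟ i ⟧))) ⟩
  sum (λ i → # (λ v → h v Finₚ.≟ i) * f i)              ∎
  where
  open ≡-Reasoning
  expand : ∀ v → sum (λ i → ⟦ h v Finₚ.≟ i ⟧ * f i) ≡ f (h v)
  expand v = begin
    sum (λ i → ⟦ h v Finₚ.≟ i ⟧ * f i)
      ≡⟨ sym (sum-image {p = 1} (λ _ → h v) (λ { {zero} {zero} _ → refl }) _
           (λ i miss → cong (_* f i) (⟦⟧-no (h v Finₚ.≟ i) (miss zero)))) ⟩
    ⟦ h v Finₚ.≟ h v ⟧ * f (h v) + 0 ≡⟨ +-identityʳ _ ⟩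
    ⟦ h v Finₚ.≟ h v ⟧ * f (h v)     ≡⟨ cong (_* f (h v)) (⟦⟧-yes (h v Finₚ.≟ h v) refl) ⟩
    1 * f (h v)                      ≡⟨ *-identityˡ _ ⟩
    f (h v) ∎

-- Orbits of a periodic map on a finite set

least : {P : ℕ → Set} (P? : ∀ i → Dec (P i)) → ∀ b → P b → Σ[ m ∈ ℕ ] P m × (∀ j → j < m → ¬ P j)
least P? b Pb with P? 0
least P? b       Pb | yes P0 = 0 , P0 , λ _ ()
least P? zero    Pb | no ¬P0 = contradiction Pb ¬P0
least P? (suc b) Pb | no ¬P0 =
  let (m , Pm , below) = least (P? ∘ suc) b Pb
  in suc m , Pm , λ { zero _ → ¬P0 ; (suc j) (s≤s j<m) → below j j<m }

iter : {A : Set} → (A → A) → ℕ → A → A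
iter f zero    x = x
iter f (suc j) x = f (iter f j x)

module _ {A : Set} (f : A → A) where

  iter-+ : ∀ i j x → iter f (i + j) x ≡ iter f i (iter f j x)
  iter-+ zero    j x = refl
  iter-+ (suc i) j x = cong f (iter-+ i j x)

  iter-iter : ∀ i j x → iter f i (iter f j x) ≡ iter f j (iter f i x)
  iter-iter i j x = trans (sym (iter-+ i j x)) (trans (cong (λ e → iter f e x) (+-comm i j)) (iter-+ j i x))

  iter-fix : ∀ q {d x} → iter f d x ≡ x → iter f (q * d) x ≡ x
  iter-fix zero    fix = refl
  iter-fix (suc q) {d} {x} fix = trans (iter-+ d (q * d) x) (trans (cong (iter f d) (iter-fix q fix)) fix)

  iter-% : ∀ e d .{{_ : NonZero d}} {x} → iter f d x ≡ x → iter f (e DM.% d) x ≡ iter f e x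
  iter-% e d {x} fix = sym (begin
    iter f e x                                           ≡⟨ cong (λ e → iter f e x) (DM.m≡m%n+[m/n]*n e d) ⟩
    iter f (e DM.% d + (e DM./ d) * d) x                 ≡⟨ iter-+ (e DM.% d) _ x ⟩
    iter f (e DM.% d) (iter f ((e DM./ d) * d) x)        ≡⟨ cong (iter f (e DM.% d)) (iter-fix (e DM./ d) fix) ⟩
    iter f (e DM.% d) x                                  ∎)
    where open ≡-Reasoning

  module _ k (f^k : ∀ x → iter f (suc k) x ≡ x) where

    -- `iter f k` is a left inverse of `f`; the period is written `suc k` so that this inverse needs
    -- no subtraction.
    periodic-injective : ∀ {x y} → f x ≡ f y → x ≡ y
    periodic-injective {x} {y} eq = begin
      x               ≡⟨ sym (f^k x) ⟩
      f (iter f k x)  ≡⟨ iter-iter 1 k x ⟩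
      iter f k (f x)  ≡⟨ cong (iter f k) eq ⟩
      iter f k (f y)  ≡⟨ iter-iter k 1 y ⟩
      f (iter f k y)  ≡⟨ f^k y ⟩
      y               ∎
      where open ≡-Reasoning

    iter-injective : ∀ i {x y} → iter f i x ≡ iter f i y → x ≡ y
    iter-injective zero    eq = eq
    iter-injective (suc i) eq = iter-injective i (periodic-injective eq)

length-filter-tabulate : {A : Set} {P : A → Set} (P? : ∀ a → Dec (P a)) (f : Fin n → A) →
                         length (filter P? (List.tabulate f)) ≡ # (P? ∘ f)
length-filter-tabulate {zero}  P? f = refl
length-filter-tabulate {suc n} P? f with P? (f zero)
... | yes _ = cong suc (length-filter-tabulate P? (f ∘ suc))
... | no _  = length-filter-tabulate P? (f ∘ suc)

map-const : {A B : Set} (f : A → B) (b : B) (xs : List A) → All (λ x → f x ≡ b) xs → map f xs ≡ replicate (length xs) b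
map-const f b []       []         = refl
map-const f b (x ∷ xs) (eq ∷ eqs) = cong₂ _∷_ eq (map-const f b xs eqs)

lookup-map : {A B : Set} (f : A → B) (xs : List A) (i : Fin (length (map f xs))) →
             List.lookup (map f xs) i ≡ f (List.lookup xs (Fin.cast (Listₚ.length-map f xs) i))
lookup-map f (x ∷ xs) zero    = refl
lookup-map f (x ∷ xs) (suc i) = lookup-map f xs i

unique⇒lookup-injective : {A : Set} {xs : List A} → Unique xs → ∀ i j → List.lookup xs i ≡ List.lookup xs j → i ≡ j
unique⇒lookup-injective (_ ∷ u)    zero    zero    eq = refl
unique⇒lookup-injective (x∉ ∷ u)   zero    (suc j) eq = contradiction eq (All.lookup x∉ (∈ₚ.∈-lookup j))
unique⇒lookup-injective (x∉ ∷ u)   (suc i) zero    eq = contradiction (sym eq) (All.lookup x∉ (∈ₚ.∈-lookup i))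
unique⇒lookup-injective (_ ∷ u)    (suc i) (suc j) eq = cong suc (unique⇒lookup-injective u i j eq)

module Orbits {L} (T : Fin L → Fin L) (k : ℕ) (T^k : ∀ v → iter T (suc k) v ≡ v) where

  private
    leastPeriod : ∀ v → Σ[ m ∈ ℕ ] iter T (suc m) v ≡ v × (∀ j → j < m → ¬ iter T (suc j) v ≡ v)
    leastPeriod v = least (λ d → iter T (suc d) v Finₚ.≟ v) k (T^k v)

  -- A successor by construction, so that reduction of exponents modulo the period is always
  -- available.
  per : Fin L → ℕ
  per v = suc (proj₁ (leastPeriod v))

  iter-per : ∀ v → iter T (per v) v ≡ v
  iter-per v = proj₁ (proj₂ (leastPeriod v))

  per-minimal : ∀ v {e} → e < per v → iter T e v ≡ v → e ≡ 0
  per-minimal v {zero}  _         _   = refl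
  per-minimal v {suc e} (s≤s e<m) fix = contradiction fix (proj₂ (proj₂ (leastPeriod v)) e e<m)

  per-∣ : ∀ v e → iter T e v ≡ v → per v ∣ e
  per-∣ v e fix = m%n≡0⇒n∣m e (per v)
    (per-minimal v (DM.m%n<n e (per v)) (trans (iter-% T e (per v) (iter-per v)) fix))

  ∣-per : ∀ v {e} → per v ∣ e → iter T e v ≡ v
  ∣-per v (divides q refl) = iter-fix T q (iter-per v)

  per-iter : ∀ i v → per (iter T i v) ≡ per v
  per-iter i v = ∣-antisym
    (per-∣ (iter T i v) (per v) (trans (iter-iter T (per v) i v) (cong (iter T i) (iter-per v))))
    (per-∣ v _ (iter-injective T k T^k i (trans (iter-iter T i (per (iter T i v)) v) (iter-per (iter T i v)))))

  private
    lowest : ∀ j v → Σ[ u ∈ Fin L ] (∃ λ i → iter T i v ≡ u) × (∀ i → i ≤ j → toℕ u ≤ toℕ (iter T i v))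
    lowest zero    v = v , (0 , refl) , λ { zero z≤n → ≤-refl }
    lowest (suc j) v with lowest j v
    ... | u , u∈ , u≤ with toℕ u ≤? toℕ (iter T (suc j) v)
    ...   | yes u≤new = u , u∈ , λ i i≤ → [ (λ i<sj → u≤ i (ℕ.s≤s⁻¹ i<sj)) , (λ { refl → u≤new }) ]′ (m≤n⇒m<n∨m≡n i≤)
    ...   | no  u≰new = iter T (suc j) v , (suc j , refl) , λ i i≤ →
      [ (λ i<sj → ≤-trans (<⇒≤ (≰⇒> u≰new)) (u≤ i (ℕ.s≤s⁻¹ i<sj))) , (λ { refl → ≤-refl }) ]′ (m≤n⇒m<n∨m≡n i≤)

  -- The least element of the orbit. Comparing the iterates 0, ..., k is enough since every point
  -- returns after `suc k` steps. A canonical choice makes lying in the same orbit a decidable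
  -- equation.
  rep : Fin L → Fin L
  rep v = proj₁ (lowest k v)

  rep∈orbit : ∀ v → ∃ λ i → iter T i v ≡ rep v
  rep∈orbit v = proj₁ (proj₂ (lowest k v))

  rep-≤ : ∀ v i → toℕ (rep v) ≤ toℕ (iter T i v)
  rep-≤ v i = subst (λ u → toℕ (rep v) ≤ toℕ u) (iter-% T i (suc k) (T^k v))
    (proj₂ (proj₂ (lowest k v)) (i DM.% suc k) (ℕ.s≤s⁻¹ (DM.m%n<n i (suc k))))

  -- The total exponent `i * k + i` is a multiple of the period `suc k`. Backward steps are thus
  -- forward steps, and orbits never need an inverse of `T`.
  iter-back : ∀ i v → iter T (i * k) (iter T i v) ≡ v
  iter-back i v = begin
    iter T (i * k) (iter T i v)  ≡⟨ sym (iter-+ T (i * k) i v) ⟩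
    iter T (i * k + i) v         ≡⟨ cong (λ e → iter T e v) (trans (+-comm (i * k) i) (sym (*-suc i k))) ⟩
    iter T (i * suc k) v         ≡⟨ iter-fix T i (T^k v) ⟩
    v                            ∎
    where open ≡-Reasoning

  rep-iter : ∀ i v → rep (iter T i v) ≡ rep v
  rep-iter i v = Finₚ.toℕ-injective (≤-antisym below above)
    where
    w : Fin L
    w = iter T i v
    below : toℕ (rep w) ≤ toℕ (rep v)
    below with j , eq ← rep∈orbit v = subst (λ u → toℕ (rep w) ≤ toℕ u)
      (trans (iter-+ T j (i * k) w) (trans (cong (iter T j) (iter-back i v)) eq)) (rep-≤ w (j + i * k))
    above : toℕ (rep v) ≤ toℕ (rep w)
    above with j , eq ← rep∈orbit w = subst (λ u → toℕ (rep v) ≤ toℕ u)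
      (trans (iter-+ T j i v) eq) (rep-≤ v (j + i))

  rep-rep : ∀ v → rep (rep v) ≡ rep v
  rep-rep v with i , eq ← rep∈orbit v = trans (cong rep (sym eq)) (rep-iter i v)

  per-rep : ∀ v → per (rep v) ≡ per v
  per-rep v with i , eq ← rep∈orbit v = trans (cong per (sym eq)) (per-iter i v)

  -- The iterates of `r` with exponent below `per r` enumerate the orbit. Two equal ones would give
  -- a smaller period, namely the difference of the exponents. A point lying `i` steps before `r`
  -- lies `i * k` steps after it, and that exponent may be reduced modulo the period.
  orbit-size : ∀ r → rep r ≡ r → # (λ v → rep v Finₚ.≟ r) ≡ per r
  orbit-size r rep-r = #-image (λ v → rep v Finₚ.≟ r) (λ j → iter T (toℕ j) r) (λ eq → Finₚ.toℕ-injective (inj eq))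
    (λ j → trans (rep-iter (toℕ j) r) rep-r) onto
    where
    inj-≤ : ∀ {i j} → i ≤ j → j < per r → iter T i r ≡ iter T j r → i ≡ j
    inj-≤ {i} {j} i≤j j<p eq = ≤-antisym i≤j (m∸n≡0⇒m≤n (per-minimal r (≤-<-trans (m∸n≤m j i) j<p)
      (iter-injective T k T^k i (begin
        iter T i (iter T (j ∸ i) r)  ≡⟨ sym (iter-+ T i (j ∸ i) r) ⟩
        iter T (i + (j ∸ i)) r       ≡⟨ cong (λ e → iter T e r) (m+[n∸m]≡n i≤j) ⟩
        iter T j r                   ≡⟨ sym eq ⟩
        iter T i r                   ∎))))
      where open ≡-Reasoning
    inj : ∀ {i j : Fin (per r)} → iter T (toℕ i) r ≡ iter T (toℕ j) r → toℕ i ≡ toℕ j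
    inj {i} {j} eq with ≤-total (toℕ i) (toℕ j)
    ... | inj₁ i≤j = inj-≤ i≤j (Finₚ.toℕ<n j) eq
    ... | inj₂ j≤i = sym (inj-≤ j≤i (Finₚ.toℕ<n i) (sym eq))
    onto : ∀ v → rep v ≡ r → ∃ λ j → iter T (toℕ j) r ≡ v
    onto v eq with i , ev ← rep∈orbit v = fromℕ< e<p , (begin
      iter T (toℕ (fromℕ< e<p)) r       ≡⟨ cong (λ e → iter T e r) (Finₚ.toℕ-fromℕ< e<p) ⟩
      iter T ((i * k) DM.% per r) r     ≡⟨ iter-% T (i * k) (per r) (iter-per r) ⟩
      iter T (i * k) r                  ≡⟨ cong (iter T (i * k)) (sym (trans ev eq)) ⟩
      iter T (i * k) (iter T i v)       ≡⟨ iter-back i v ⟩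
      v                                 ∎)
      where
      open ≡-Reasoning
      e<p : (i * k) DM.% per r < per r
      e<p = DM.m%n<n (i * k) (per r)

  isRepOfPeriod? : ∀ d r → Dec (rep r ≡ r × per r ≡ d)
  isRepOfPeriod? d r = (rep r Finₚ.≟ r) ×-dec (per r ℕ.≟ d)

  period-count : ∀ d → # (λ v → per v ℕ.≟ d) ≡ # (isRepOfPeriod? d) * d
  period-count d = begin
    # (λ v → per v ℕ.≟ d)
      ≡⟨ #-cong (λ v → per v ℕ.≟ d) (λ v → per (rep v) ℕ.≟ d) (λ v → trans (per-rep v)) (λ v → trans (sym (per-rep v))) ⟩
    # (λ v → per (rep v) ℕ.≟ d)
      ≡⟨ sum-fibres rep (λ r → ⟦ per r ℕ.≟ d ⟧) ⟩
    sum (λ r → # (λ v → rep v Finₚ.≟ r) * ⟦ per r ℕ.≟ d ⟧)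
      ≡⟨ sum-cong-≗ term ⟩
    sum (λ r → ⟦ isRepOfPeriod? d r ⟧ * d)
      ≡⟨ sym (*-distribʳ-sum d (λ r → ⟦ isRepOfPeriod? d r ⟧)) ⟩
    # (isRepOfPeriod? d) * d ∎
    where
    open ≡-Reasoning
    split : ∀ r (d₁ : Dec (rep r ≡ r)) (d₂ : Dec (per r ≡ d)) → # (λ v → rep v Finₚ.≟ r) * ⟦ d₂ ⟧ ≡ ⟦ d₁ ×-dec d₂ ⟧ * d
    split r (yes rep-r) (yes refl) = trans (*-identityʳ _) (trans (orbit-size r rep-r) (sym (*-identityˡ d)))
    split r (yes rep-r) (no _)     = *-zeroʳ (# (λ v → rep v Finₚ.≟ r))
    split r (no ¬rep-r) _          = cong (_* _) (#-none (λ v → rep v Finₚ.≟ r)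
      λ v eq → ¬rep-r (trans (cong rep (sym eq)) (trans (rep-rep v) eq)))
    term : ∀ r → # (λ v → rep v Finₚ.≟ r) * ⟦ per r ℕ.≟ d ⟧ ≡ ⟦ isRepOfPeriod? d r ⟧ * d
    term r = split r (rep r Finₚ.≟ r) (per r ℕ.≟ d)

  repsOf : ℕ → List (Fin L)
  repsOf d = filter (isRepOfPeriod? d) (allFin L)

  reps : List ℕ → List (Fin L)
  reps = concatMap repsOf

  ∈-reps⁻ : ∀ ds {r} → r ∈ reps ds → rep r ≡ r × per r ∈ ds
  ∈-reps⁻ (d ∷ ds) r∈ with ∈ₚ.∈-++⁻ (repsOf d) r∈
  ... | inj₁ r∈d  = let (_ , rep-r , per-r) = ∈ₚ.∈-filter⁻ (isRepOfPeriod? d) {xs = allFin L} r∈d in rep-r , here per-r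
  ... | inj₂ r∈ds = let (rep-r , per-r) = ∈-reps⁻ ds r∈ds in rep-r , there per-r

  ∈-reps⁺ : ∀ ds {r} → rep r ≡ r → per r ∈ ds → r ∈ reps ds
  ∈-reps⁺ (d ∷ ds) {r} rep-r (here eq)  = ∈ₚ.∈-++⁺ˡ (∈ₚ.∈-filter⁺ (isRepOfPeriod? d) (∈ₚ.∈-allFin r) (rep-r , eq))
  ∈-reps⁺ (d ∷ ds)     rep-r (there p∈) = ∈ₚ.∈-++⁺ʳ (repsOf d) (∈-reps⁺ ds rep-r p∈)

  reps-unique : ∀ ds → Unique ds → Unique (reps ds)
  reps-unique []       _          = []
  reps-unique (d ∷ ds) (d∉ds ∷ u) = Uniqueₚ.++⁺ (Uniqueₚ.filter⁺ (isRepOfPeriod? d) (Uniqueₚ.allFin⁺ L)) (reps-unique ds u)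
    λ { (r∈d , r∈ds) → All.lookup d∉ds (proj₂ (∈-reps⁻ ds r∈ds))
                         (sym (proj₂ (proj₂ (∈ₚ.∈-filter⁻ (isRepOfPeriod? d) {xs = allFin L} r∈d)))) }

  length-repsOf : ∀ d → length (repsOf d) ≡ # (isRepOfPeriod? d)
  length-repsOf d = length-filter-tabulate (isRepOfPeriod? d) id

  -- The order of concatenation in `reps` copies that of `weights`, so the two lists are equal and
  -- not merely permutations of each other; a position in `weights k` can then serve as the name of
  -- an orbit.
  map-per-reps : (M : ℕ → ℕ) → ∀ ds → All (λ d → # (isRepOfPeriod? d) ≡ M d) ds →
                 map per (reps ds) ≡ concatMap (λ d → replicate (M d) d) ds
  map-per-reps M []       []         = refl
  map-per-reps M (d ∷ ds) (eq ∷ eqs) = begin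
    map per (repsOf d ++ reps ds)              ≡⟨ Listₚ.map-++ per (repsOf d) (reps ds) ⟩
    map per (repsOf d) ++ map per (reps ds)    ≡⟨ cong₂ _++_
      (trans (map-const per d (repsOf d) (All.map proj₂ (Allₚ.all-filter (isRepOfPeriod? d) (allFin L))))
             (cong (λ c → replicate c d) (trans (length-repsOf d) eq)))
      (map-per-reps M ds eqs) ⟩
    replicate (M d) d ++ concatMap (λ d → replicate (M d) d) ds ∎
    where open ≡-Reasoning

  -- All that the bijection needs to know about the orbits. The weight list is a parameter so that
  -- an indexing can be transported to `weights k`.
  record OrbitIndexing (ws : List ℕ) : Set where
    field
      orbitOf : Fin L → Fin (length ws)
      elementOf : Fin (length ws) → Fin L
      orbitOf-elementOf : ∀ i → orbitOf (elementOf i) ≡ i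
      orbitOf-T : ∀ v → orbitOf (T v) ≡ orbitOf v
      elementOf-orbitOf : ∀ v → ∃ λ i → iter T i v ≡ elementOf (orbitOf v)
      orbit-weight : ∀ i → # (λ v → orbitOf v Finₚ.≟ i) ≡ List.lookup ws i

  orbitIndexing : ∀ ds → Unique ds → (∀ v → per v ∈ ds) → OrbitIndexing (map per (reps ds))
  orbitIndexing ds u per∈ = record
    { orbitOf = orbitOf
    ; elementOf = elementOf
    ; orbitOf-elementOf = λ i → elementOf-injective (trans (elementOf-orbitOf (elementOf i)) (rep-elementOf i))
    ; orbitOf-T = λ v → elementOf-injective (trans (elementOf-orbitOf (T v)) (trans (rep-iter 1 v) (sym (elementOf-orbitOf v))))
    ; elementOf-orbitOf = λ v → let (i , eq) = rep∈orbit v in i , trans eq (sym (elementOf-orbitOf v))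
    ; orbit-weight = λ i → begin
        # (λ v → orbitOf v Finₚ.≟ i)
          ≡⟨ #-cong (λ v → orbitOf v Finₚ.≟ i) (λ v → rep v Finₚ.≟ elementOf i)
               (λ { v refl → sym (elementOf-orbitOf v) })
               (λ v eq → elementOf-injective (trans (elementOf-orbitOf v) eq)) ⟩
        # (λ v → rep v Finₚ.≟ elementOf i)
          ≡⟨ orbit-size (elementOf i) (rep-elementOf i) ⟩
        per (elementOf i)
          ≡⟨ sym (lookup-map per rs i) ⟩
        List.lookup (map per rs) i ∎
    }
    where
    open ≡-Reasoning
    rs : List (Fin L)
    rs = reps ds
    len : length (map per rs) ≡ length rs
    len = Listₚ.length-map per rs
    elementOf : Fin (length (map per rs)) → Fin L
    elementOf i = List.lookup rs (Fin.cast len i)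
    rep∈ : ∀ v → rep v ∈ rs
    rep∈ v = ∈-reps⁺ ds (rep-rep v) (subst (_∈ ds) (sym (per-rep v)) (per∈ v))
    orbitOf : Fin L → Fin (length (map per rs))
    orbitOf v = Fin.cast (sym len) (Any.index (rep∈ v))
    elementOf-orbitOf : ∀ v → elementOf (orbitOf v) ≡ rep v
    elementOf-orbitOf v = trans
      (cong (List.lookup rs) (trans (Finₚ.cast-trans (sym len) len (Any.index (rep∈ v))) (Finₚ.cast-is-id refl _)))
      (sym (Anyₚ.lookup-index (rep∈ v)))
    elementOf-injective : ∀ {i j} → elementOf i ≡ elementOf j → i ≡ j
    elementOf-injective {i} {j} eq = Finₚ.toℕ-injective (begin
      toℕ i                ≡⟨ sym (Finₚ.toℕ-cast len i) ⟩
      toℕ (Fin.cast len i) ≡⟨ cong toℕ (unique⇒lookup-injective (reps-unique ds u) _ _ eq) ⟩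
      toℕ (Fin.cast len j) ≡⟨ Finₚ.toℕ-cast len j ⟩
      toℕ j                ∎)
    rep-elementOf : ∀ i → rep (elementOf i) ≡ elementOf i
    rep-elementOf i = proj₁ (∈-reps⁻ ds (∈ₚ.∈-lookup (Fin.cast len i)))

-- The doubling map

residue-unique : ∀ M .{{_ : NonZero M}} {a b} q r → a < M → b < M → a + q * M ≡ b + r * M → a ≡ b
residue-unique M {a} {b} q r a<M b<M eq = begin
  a                ≡⟨ sym (DM.m<n⇒m%n≡m a<M) ⟩
  a DM.% M           ≡⟨ sym (DM.[m+kn]%n≡m%n a q M) ⟩
  (a + q * M) DM.% M ≡⟨ cong (DM._% M) eq ⟩
  (b + r * M) DM.% M ≡⟨ DM.[m+kn]%n≡m%n b r M ⟩
  b DM.% M           ≡⟨ DM.m<n⇒m%n≡m b<M ⟩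
  b                ∎
  where open ≡-Reasoning

-- The element v of Fin L stands for the residue suc v modulo M = suc L = 2 ^ k ∸ 1.  Binary words of length k
-- other than the two constant ones are the binary expansions of 1, …, L, and rotating a word by one letter
-- doubles the corresponding residue.
module Doubling (k′ L : ℕ) (2+L≡2^k : 2 + L ≡ 2 ^ suc k′) where

  M : ℕ
  M = suc L

  private
    L-even : ∃ λ h → L ≡ 2 * h
    L-even with 2 ^ k′ in eq
    ... | zero = contradiction eq (>⇒≢ (m^n>0 2 k′))
    ... | suc h = h , +-cancelˡ-≡ 2 L (2 * h) (trans 2+L≡2^k (*-suc 2 h))

  -- On residues this is 2 * suc v, less `M` when it is not below `M`. Indices are one less than
  -- residues, which gives 1 + 2 v and 2 v - L; that the second subtraction does not truncate is
  -- part of `double-spec`.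
  double : Fin L → Fin L
  double v with 1 + 2 * toℕ v <? L
  ... | yes <L = fromℕ< <L
  ... | no  _  = fromℕ< {2 * toℕ v ∸ L} (m<n+o⇒m∸n<o (2 * toℕ v) L {{Finₚ.nonZeroIndex v}} (begin-strict
        2 * toℕ v          ≡⟨ cong (toℕ v +_) (+-identityʳ (toℕ v)) ⟩
        toℕ v + toℕ v      <⟨ +-mono-< (Finₚ.toℕ<n v) (Finₚ.toℕ<n v) ⟩
        L + L              ∎))
    where open ≤-Reasoning

  double-spec : ∀ v → suc (toℕ (double v)) ≡ 2 * suc (toℕ v) ⊎ suc (toℕ (double v)) + M ≡ 2 * suc (toℕ v)
  double-spec v with 1 + 2 * toℕ v <? L
  ... | yes <L = inj₁ (trans (cong suc (Finₚ.toℕ-fromℕ< <L)) (sym (*-suc 2 (toℕ v))))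
  ... | no  ≮L = inj₂ (begin
        suc (toℕ (fromℕ< _)) + M     ≡⟨ cong (λ x → suc x + M) (Finₚ.toℕ-fromℕ< _) ⟩
        suc (2 * toℕ v ∸ L) + suc L  ≡⟨ +-suc (suc (2 * toℕ v ∸ L)) L ⟩
        2 + (2 * toℕ v ∸ L + L)      ≡⟨ cong (2 +_) (m∸n+n≡m L≤2v) ⟩
        2 + 2 * toℕ v                ≡⟨ sym (*-suc 2 (toℕ v)) ⟩
        2 * suc (toℕ v)              ∎)
    where
    open ≡-Reasoning
    L≤2v : L ≤ 2 * toℕ v
    L≤2v with m≤n⇒m<n∨m≡n (≮⇒≥ ≮L)
    ... | inj₁ (s≤s le) = le
    -- Here 2 * suc v would equal `M`, that is, residue 0, which has no index; `M` is odd, so this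
    -- cannot happen.
    ... | inj₂ eq       = let (h , L≡2h) = L-even in contradiction (trans (sym L≡2h) eq) (even≢odd h (toℕ v))

  private
    suc<M : (v : Fin L) → suc (toℕ v) < M
    suc<M v = s≤s (Finₚ.toℕ<n v)

  double-mod : ∀ v → ∃ λ q → suc (toℕ (double v)) + q * M ≡ 2 * suc (toℕ v)
  double-mod v with double-spec v
  ... | inj₁ eq = 0 , trans (+-identityʳ _) eq
  ... | inj₂ eq = 1 , trans (cong (suc (toℕ (double v)) +_) (*-identityˡ M)) eq

  double-unique : ∀ v w q → suc (toℕ w) + q * M ≡ 2 * suc (toℕ v) → double v ≡ w
  double-unique v w q eq = let (r , eq′) = double-mod v in
    Finₚ.toℕ-injective (suc-injective (residue-unique M r q (suc<M (double v)) (suc<M w) (trans eq′ (sym eq))))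

  iter-double-mod : ∀ j v → ∃ λ q → suc (toℕ (iter double j v)) + q * M ≡ 2 ^ j * suc (toℕ v)
  iter-double-mod zero    v = 0 , trans (+-identityʳ _) (sym (*-identityˡ _))
  iter-double-mod (suc j) v =
    let w = iter double j v
        (q , eq) = iter-double-mod j v
        (r , eq′) = double-mod w
    in r + 2 * q , (begin
      suc (toℕ (double w)) + (r + 2 * q) * M      ≡⟨ regroup (suc (toℕ (double w))) r q M ⟩
      (suc (toℕ (double w)) + r * M) + 2 * (q * M) ≡⟨ cong (_+ 2 * (q * M)) eq′ ⟩
      2 * suc (toℕ w) + 2 * (q * M)               ≡⟨ sym (*-distribˡ-+ 2 (suc (toℕ w)) (q * M)) ⟩
      2 * (suc (toℕ w) + q * M)                   ≡⟨ cong (2 *_) eq ⟩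
      2 * (2 ^ j * suc (toℕ v))                   ≡⟨ sym (*-assoc 2 (2 ^ j) (suc (toℕ v))) ⟩
      2 ^ suc j * suc (toℕ v)                     ∎)
    where
    open ≡-Reasoning
    regroup : ∀ a r q m → a + (r + 2 * q) * m ≡ (a + r * m) + 2 * (q * m)
    regroup = solve-∀

  iter-double-unique : ∀ j v w q → suc (toℕ w) + q * M ≡ 2 ^ j * suc (toℕ v) → iter double j v ≡ w
  iter-double-unique j v w q eq = let (r , eq′) = iter-double-mod j v in
    Finₚ.toℕ-injective (suc-injective (residue-unique M r q (suc<M (iter double j v)) (suc<M w) (trans eq′ (sym eq))))

  -- Since 2^k = 1 + M, the quotient of 2^k times a residue by `M` is the residue itself.
  double^k : ∀ v → iter double (suc k′) v ≡ v
  double^k v = iter-double-unique (suc k′) v v (suc (toℕ v)) (begin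
    suc (toℕ v) + suc (toℕ v) * M  ≡⟨ sym (*-suc (suc (toℕ v)) M) ⟩
    suc (toℕ v) * (2 + L)          ≡⟨ *-comm (suc (toℕ v)) (2 + L) ⟩
    (2 + L) * suc (toℕ v)          ≡⟨ cong (_* suc (toℕ v)) 2+L≡2^k ⟩
    2 ^ suc k′ * suc (toℕ v)       ∎)
    where open ≡-Reasoning

  double-direction : ∀ v → (toℕ v < toℕ (double v) × suc (toℕ (double v)) ≡ 2 * suc (toℕ v))
                         ⊎ (toℕ (double v) < toℕ v × suc (toℕ (double v)) + M ≡ 2 * suc (toℕ v))
  double-direction v with double-spec v
  ... | inj₁ eq = inj₁ (ℕ.s<s⁻¹ (subst (suc (toℕ v) <_) (sym eq) (m<m+n (suc (toℕ v)) (s≤s z≤n))) , eq)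
  ... | inj₂ eq = inj₂ (ℕ.s<s⁻¹ (+-cancelʳ-< M (suc (toℕ (double v))) (suc (toℕ v)) (begin-strict
        suc (toℕ (double v)) + M       ≡⟨ eq ⟩
        2 * suc (toℕ v)                ≡⟨ cong (suc (toℕ v) +_) (+-identityʳ _) ⟩
        suc (toℕ v) + suc (toℕ v)      <⟨ +-monoʳ-< (suc (toℕ v)) (suc<M v) ⟩
        suc (toℕ v) + M                ∎)) , eq)
    where open ≤-Reasoning

  double-≢ : ∀ v → double v ≢ v
  double-≢ v eq with double-direction v
  ... | inj₁ (lt , _) = <-irrefl (sym (cong toℕ eq)) lt
  ... | inj₂ (lt , _) = <-irrefl (cong toℕ eq) lt

  -- No reduction takes place at `v`, so none does at the smaller `u`: it would require M < 2 * suc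
  -- u < 2 * suc v < M. Both images are then plain doubles. `double-down` is the mirror image, with
  -- a reduction at both points.
  double-up : ∀ {u v} → toℕ v < toℕ (double v) → toℕ u < toℕ v →
              toℕ u < toℕ (double u) × toℕ (double u) < toℕ (double v)
  double-up {u} {v} up u<v with double-direction v | double-direction u
  ... | inj₂ (down , _) | _                = contradiction up (<⇒≯ down)
  ... | inj₁ (_ , eqv)  | inj₁ (upu , equ) = upu , ℕ.s<s⁻¹ (subst₂ _<_ (sym equ) (sym eqv) (*-monoʳ-< 2 (s≤s u<v)))
  ... | inj₁ (_ , eqv)  | inj₂ (_   , equ) = contradiction
        (subst₂ _<_ (sym equ) (sym eqv) (*-monoʳ-< 2 (s≤s u<v)))
        (<-asym (<-≤-trans (suc<M (double v)) (m≤n+m M (suc (toℕ (double u))))))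

  double-down : ∀ {u v} → toℕ (double u) < toℕ u → toℕ u < toℕ v →
                toℕ (double v) < toℕ v × toℕ (double u) < toℕ (double v)
  double-down {u} {v} down u<v with double-direction u | double-direction v
  ... | inj₁ (up , _)  | _                = contradiction up (<⇒≯ down)
  ... | inj₂ (_ , equ) | inj₂ (dnv , eqv) = dnv , ℕ.s<s⁻¹ (+-cancelʳ-< M _ _ (subst₂ _<_ (sym equ) (sym eqv) (*-monoʳ-< 2 (s≤s u<v))))
  ... | inj₂ (_ , equ) | inj₁ (_   , eqv) = contradiction
        (subst₂ _<_ (sym equ) (sym eqv) (*-monoʳ-< 2 (s≤s u<v)))
        (<-asym (<-≤-trans (suc<M (double v)) (m≤n+m M (suc (toℕ (double u))))))

  private
    -- That 2^d - 1 divides 2^(t d) - 1. The cofactor `Q` is the geometric sum 1 + 2^d + ⋯ +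
    -- 2^((t-1) d); the summand `suc (a * Q)` added at each step is its next term 2^(t d).
    geometric : ∀ {a d} → 2 ^ d ≡ suc a → ∀ t → ∃ λ Q → 2 ^ (t * d) ≡ suc (a * Q)
    geometric {a} {d} eq zero    = 0 , cong suc (sym (*-zeroʳ a))
    geometric {a} {d} eq (suc t) = let (Q , eqt) = geometric {a} {d} eq t in Q + suc (a * Q) , (begin
      2 ^ (d + t * d)              ≡⟨ ^-distribˡ-+-* 2 d (t * d) ⟩
      2 ^ d * 2 ^ (t * d)          ≡⟨ cong₂ _*_ eq eqt ⟩
      suc a * suc (a * Q)          ≡⟨ expand a Q ⟩
      suc (a * (Q + suc (a * Q)))  ∎)
      where
      open ≡-Reasoning
      expand : ∀ a Q → (1 + a) * (1 + a * Q) ≡ 1 + a * (Q + (1 + a * Q))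
      expand = solve-∀

  -- A residue is fixed by doubling d times exactly when `M` divides 2^d - 1 times it. Since M =
  -- (2^d - 1) * suc Q, these are the multiples of `suc Q` strictly between 0 and `M`, the j-th
  -- being (j + 1) * suc Q.
  double-fixed-count : ∀ d → d ∣ suc k′ → # (λ v → iter double d v Finₚ.≟ v) ≡ 2 ^ d ∸ 2
  double-fixed-count zero    0∣k = contradiction (0∣⇒≡0 0∣k) λ ()
  double-fixed-count (suc d) (divides t k≡td) with 2 ^ suc d in eq
  ... | zero        = contradiction eq (>⇒≢ (m^n>0 2 (suc d)))
  ... | suc zero    = contradiction eq (even≢odd (2 ^ d) 0)
  ... | suc (suc a) with geometric {suc a} {suc d} eq t
  ...   | zero  , eqt = contradiction (trans 2+L≡2^k (trans (cong (2 ^_) k≡td) (trans eqt (cong suc (*-zeroʳ (suc a)))))) λ ()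
  ...   | suc Q , eqt = #-image (λ v → iter double (suc d) v Finₚ.≟ v) multiple
          (λ {i} {j} e → Finₚ.toℕ-injective (suc-injective (*-cancelʳ-≡ _ _ (suc Q)
             (trans (sym (toℕ-multiple i)) (trans (cong (suc ∘ toℕ) e) (toℕ-multiple j))))))
          multiple-fixed onto
    where
    swap : ∀ x y z → x * (y * z) ≡ y * (x * z)
    swap = solve-∀
    open ≡-Reasoning
    M≡ : M ≡ suc a * suc Q
    M≡ = suc-injective (trans 2+L≡2^k (trans (cong (2 ^_) k≡td) eqt))
    bound : ∀ (j : Fin a) → Q + toℕ j * suc Q < L
    bound j = subst (Q + toℕ j * suc Q <_) (sym (suc-injective M≡))
      (<-≤-trans (*-monoˡ-≤ (suc Q) (Finₚ.toℕ<n j)) (m≤n+m (a * suc Q) Q))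
    multiple : Fin a → Fin L
    multiple j = fromℕ< (bound j)
    toℕ-multiple : ∀ j → suc (toℕ (multiple j)) ≡ suc (toℕ j) * suc Q
    toℕ-multiple j = cong suc (Finₚ.toℕ-fromℕ< (bound j))
    2^d*v : ∀ v → 2 ^ suc d * suc (toℕ v) ≡ suc (toℕ v) + suc a * suc (toℕ v)
    2^d*v v = cong (_* suc (toℕ v)) eq
    multiple-fixed : ∀ j → iter double (suc d) (multiple j) ≡ multiple j
    multiple-fixed j = iter-double-unique (suc d) v v (suc (toℕ j)) (begin
      suc (toℕ v) + suc (toℕ j) * M                 ≡⟨ cong (suc (toℕ v) +_) (begin
        suc (toℕ j) * M                   ≡⟨ cong (suc (toℕ j) *_) M≡ ⟩
        suc (toℕ j) * (suc a * suc Q)     ≡⟨ swap (suc (toℕ j)) (suc a) (suc Q) ⟩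
        suc a * (suc (toℕ j) * suc Q)     ≡⟨ cong (suc a *_) (sym (toℕ-multiple j)) ⟩
        suc a * suc (toℕ v)               ∎) ⟩
      suc (toℕ v) + suc a * suc (toℕ v)             ≡⟨ sym (2^d*v v) ⟩
      2 ^ suc d * suc (toℕ v)                       ∎)
      where
      v : Fin L
      v = multiple j
    onto : ∀ v → iter double (suc d) v ≡ v → ∃ λ j → multiple j ≡ v
    onto v fix with iter-double-mod (suc d) v
    ... | q , eqq = found q (*-cancelˡ-≡ _ _ (suc a) (begin
          suc a * (q * suc Q)   ≡⟨ swap (suc a) q (suc Q) ⟩
          q * (suc a * suc Q)   ≡⟨ cong (q *_) (sym M≡) ⟩
          q * M                 ≡⟨ +-cancelˡ-≡ (suc (toℕ v)) _ _ (trans (cong (λ u → suc (toℕ u) + q * M) (sym fix)) (trans eqq (2^d*v v))) ⟩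
          suc a * suc (toℕ v)   ∎))
      where
      found : ∀ q → q * suc Q ≡ suc (toℕ v) → ∃ λ j → multiple j ≡ v
      found (suc q) e = fromℕ< q<a , Finₚ.toℕ-injective (suc-injective
          (trans (toℕ-multiple (fromℕ< q<a)) (trans (cong (λ x → suc x * suc Q) (Finₚ.toℕ-fromℕ< q<a)) e)))
        where
        q<a : q < a
        q<a = ℕ.s<s⁻¹ (*-cancelʳ-< (suc Q) (suc q) (suc a) (subst₂ _<_ (sym e) M≡ (suc<M v)))

-- The Möbius function

module ℤ∑′ = SumOverImage ℤₚ.+-0-commutativeMonoid

length-filter-primesUpTo : {P : ℕ → Set} (P? : ∀ e → Dec (P e)) → ∀ n →
  length (filter P? (primesUpTo n)) ≡ # {n} (λ i → prime? (suc (toℕ i)) ×-dec P? (suc (toℕ i)))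
length-filter-primesUpTo {P} P? n = go n id
  where
  -- Generalized from `id` because the tail of `applyUpTo h` is `applyUpTo (h ∘ suc)`.
  go : ∀ n (h : ℕ → ℕ) → length (filter P? (filter prime? (map suc (List.applyUpTo h n))))
                       ≡ # {n} (λ i → prime? (suc (h (toℕ i))) ×-dec P? (suc (h (toℕ i))))
  go zero    h = refl
  go (suc n) h with prime? (suc (h 0))
  ... | no _  = go n (h ∘ suc)
  ... | yes _ with P? (suc (h 0))
  ...   | yes _ = cong suc (go n (h ∘ suc))
  ...   | no _  = go n (h ∘ suc)

sum-filter-upTo : {P : ℕ → Set} (P? : ∀ e → Dec (P e)) (f : ℕ → ℤ) → ∀ n →
  List.foldr ℤ._+_ (⁺ 0) (map f (filter P? (map suc (List.upTo n))))
  ≡ ℤ∑.sum {n} (λ i → ⁺ ⟦ P? (suc (toℕ i)) ⟧ ℤ.* f (suc (toℕ i)))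
sum-filter-upTo {P} P? f n = go n id
  where
  go : ∀ n (h : ℕ → ℕ) → List.foldr ℤ._+_ (⁺ 0) (map f (filter P? (map suc (List.applyUpTo h n))))
                       ≡ ℤ∑.sum {n} (λ i → ⁺ ⟦ P? (suc (h (toℕ i))) ⟧ ℤ.* f (suc (h (toℕ i))))
  go zero    h = refl
  go (suc n) h with P? (suc (h 0))
  ... | yes _ = cong₂ ℤ._+_ (sym (ℤₚ.*-identityˡ (f (suc (h 0))))) (go n (h ∘ suc))
  ... | no _  = trans (go n (h ∘ suc)) (trans (sym (ℤₚ.+-identityˡ rest))
                  (cong (ℤ._+ rest) (sym (ℤₚ.*-zeroˡ (f (suc (h 0)))))))
    where
    rest : ℤ
    rest = ℤ∑.sum {n} (λ i → ⁺ ⟦ P? (suc (h (suc (toℕ i)))) ⟧ ℤ.* f (suc (h (suc (toℕ i)))))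

∈-primesUpTo : ∀ {q n} → Prime q → q ≤ n → q ∈ primesUpTo n
∈-primesUpTo {zero}  pq _   = contradiction refl (ℕ.≢-nonZero⁻¹ 0 {{prime⇒nonZero pq}})
∈-primesUpTo {suc q} pq q<n = ∈ₚ.∈-filter⁺ prime? (∈ₚ.∈-map⁺ suc (∈ₚ.∈-upTo⁺ q<n)) pq

primeDivisorCount : ℕ → ℕ
primeDivisorCount d = length (filter (_∣? d) (primesUpTo d))

SquareFree : ℕ → Set
SquareFree d = ∀ q → Prime q → ¬ q * q ∣ d

private
  -- The very list whose length `μ` inspects, so that a `with` on it makes `μ` reduce.
  squareDivisors : ℕ → List ℕ
  squareDivisors d = filter (λ q → (q * q) ∣? d) (primesUpTo d)

  ∈-squareDivisors : ∀ {d q} .{{_ : NonZero d}} → Prime q → q * q ∣ d → q ∈ squareDivisors d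
  ∈-squareDivisors {d} {q} pq q²∣d = ∈ₚ.∈-filter⁺ (λ q → (q * q) ∣? d)
    (∈-primesUpTo pq (≤-trans (m≤m*n q q {{prime⇒nonZero pq}}) (∣⇒≤ q²∣d))) q²∣d

  squareDivisors-prime : ∀ {d q} → q ∈ squareDivisors d → Prime q × q * q ∣ d
  squareDivisors-prime {d} q∈ =
    let (q∈primes , q²∣d) = ∈ₚ.∈-filter⁻ (λ q → (q * q) ∣? d) {xs = primesUpTo d} q∈
    in proj₂ (∈ₚ.∈-filter⁻ prime? {xs = map suc (List.upTo d)} q∈primes) , q²∣d

squareFree? : ∀ d .{{_ : NonZero d}} → (∃ λ q → Prime q × q * q ∣ d) ⊎ SquareFree d
squareFree? d with squareDivisors d in eq
... | q ∷ _ = inj₁ (q , squareDivisors-prime (subst (q ∈_) (sym eq) (here refl)))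
... | []    = inj₂ λ q pq q²∣d → contradiction (subst (q ∈_) eq (∈-squareDivisors pq q²∣d)) λ ()

μ-square : ∀ d {q} → Prime q → q * q ∣ suc d → μ (suc d) ≡ ⁺ 0
μ-square d {q} pq q²∣d with squareDivisors (suc d) in eq
... | _ ∷ _ = refl
... | []    = contradiction (subst (q ∈_) eq (∈-squareDivisors pq q²∣d)) λ ()

μ-squareFree : ∀ d → SquareFree (suc d) → μ (suc d) ≡ (ℤ.- (⁺ 1)) ℤ.^ primeDivisorCount (suc d)
μ-squareFree d free with squareDivisors (suc d) in eq
... | []    = refl
... | q ∷ _ = let (pq , q²∣d) = squareDivisors-prime (subst (q ∈_) (sym eq) (here refl)) in contradiction q²∣d (free q pq)

prime∣prime⇒≡ : ∀ {p q} → Prime p → Prime q → q ∣ p → q ≡ p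
prime∣prime⇒≡ pp pq q∣p with prime⇒irreducible pp q∣p
... | inj₁ refl = contradiction pq ¬prime[1]
... | inj₂ eq   = eq

module _ {p} (pp : Prime (suc p)) where

  -- By Euclid's lemma a prime divisor of the product is the new prime or divides the old factor,
  -- and not both. The count on the old factor runs over a shorter range, which is harmless since
  -- divisors of a positive number do not exceed it.
  primeDivisorCount-* : ∀ c → ¬ suc p ∣ suc c → primeDivisorCount (suc p * suc c) ≡ suc (primeDivisorCount (suc c))
  primeDivisorCount-* c p∤c = begin
    primeDivisorCount m                  ≡⟨ length-filter-primesUpTo (_∣? m) m ⟩
    # {m} (λ i → dividing? m (suc (toℕ i))) ≡⟨ #-⊎ (λ i → p ℕ.≟ toℕ i) (λ i → dividing? (suc c) (suc (toℕ i))) (λ i → dividing? m (suc (toℕ i)))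
                                                   split
                                                   (λ i p≡i → subst (λ q → Prime (suc q) × suc q ∣ m) p≡i (pp , m∣m*n (suc c)))
                                                   (λ { i (pq , q∣c) → pq , ∣-trans q∣c (n∣m*n (suc p)) })
                                                   (λ i (p≡i , _ , q∣c) → p∤c (subst (λ q → suc q ∣ suc c) (sym p≡i) q∣c)) ⟩
    # {m} (λ i → p ℕ.≟ toℕ i) + # {m} (λ i → dividing? (suc c) (suc (toℕ i)))
      ≡⟨ cong₂ _+_ (#-single (λ i → p ℕ.≟ toℕ i) (fromℕ< p<m) (sym (Finₚ.toℕ-fromℕ< p<m))
                     (λ u p≡u → Finₚ.toℕ-injective (trans (Finₚ.toℕ-fromℕ< p<m) p≡u)))
                   (sym (sum-extend (m≤n*m (suc c) (suc p)) (λ e → ⟦ dividing? (suc c) (suc e) ⟧)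
                     (λ e c≤e → ⟦⟧-no (dividing? (suc c) (suc e)) λ (_ , e∣c) → <⇒≱ (s≤s c≤e) (∣⇒≤ e∣c)))) ⟩
    1 + # {suc c} (λ i → dividing? (suc c) (suc (toℕ i)))
      ≡⟨ cong suc (sym (length-filter-primesUpTo (_∣? suc c) (suc c))) ⟩
    suc (primeDivisorCount (suc c)) ∎
    where
    open ≡-Reasoning
    m : ℕ
    m = suc p * suc c
    dividing? : ∀ m q → Dec (Prime q × q ∣ m)
    dividing? m q = prime? q ×-dec q ∣? m
    p<m : p < m
    p<m = m≤m*n (suc p) (suc c)
    split : ∀ (i : Fin m) → Prime (suc (toℕ i)) × suc (toℕ i) ∣ m → p ≡ toℕ i ⊎ (Prime (suc (toℕ i)) × suc (toℕ i) ∣ suc c)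
    split i (pq , q∣m) with euclidsLemma (suc p) (suc c) pq q∣m
    ... | inj₁ q∣p = inj₁ (sym (suc-injective (prime∣prime⇒≡ pp pq q∣p)))
    ... | inj₂ q∣c = inj₂ (pq , q∣c)

  -- If the prime q is the new one, cancelling it contradicts coprimality. Otherwise Euclid's lemma
  -- is applied twice, each time taking one factor q out of the old number, whose square divisor q *
  -- q is then excluded.
  squareFree-* : ∀ c → ¬ suc p ∣ suc c → SquareFree (suc c) → SquareFree (suc p * suc c)
  squareFree-* c p∤c free q pq q²∣pc with q ℕ.≟ suc p
  ... | yes refl = p∤c (*-cancelˡ-∣ (suc p) q²∣pc)
  ... | no  q≢p  with euclidsLemma (suc p) (suc c) pq (∣-trans (m∣m*n q) q²∣pc)
  ...   | inj₁ q∣p = q≢p (prime∣prime⇒≡ pp pq q∣p)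
  ...   | inj₂ (divides c′ c≡) with euclidsLemma (suc p) c′ pq (*-cancelʳ-∣ q {{prime⇒nonZero pq}}
                                      (subst (q * q ∣_) (trans (cong (suc p *_) c≡) (sym (*-assoc (suc p) c′ q))) q²∣pc))
  ...     | inj₁ q∣p  = q≢p (prime∣prime⇒≡ pp pq q∣p)
  ...     | inj₂ q∣c′ = free q pq (subst (q * q ∣_) (sym c≡) (*-monoˡ-∣ q q∣c′))

  μ-prime-* : ∀ c → ¬ suc p ∣ suc c → μ (suc p * suc c) ≡ ℤ.- μ (suc c)
  μ-prime-* c p∤c with squareFree? (suc c)
  ... | inj₁ (q , pq , q²∣c) = trans (μ-square _ pq (∣-trans q²∣c (n∣m*n (suc p)))) (cong ℤ.-_ (sym (μ-square c pq q²∣c)))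
  ... | inj₂ free = begin
        μ (suc p * suc c)                                          ≡⟨ μ-squareFree _ (squareFree-* c p∤c free) ⟩
        (ℤ.- (⁺ 1)) ℤ.^ primeDivisorCount (suc p * suc c)          ≡⟨ cong ((ℤ.- (⁺ 1)) ℤ.^_) (primeDivisorCount-* c p∤c) ⟩
        (ℤ.- (⁺ 1)) ℤ.* (ℤ.- (⁺ 1)) ℤ.^ primeDivisorCount (suc c)  ≡⟨ ℤₚ.-1*i≡-i _ ⟩
        ℤ.- ((ℤ.- (⁺ 1)) ℤ.^ primeDivisorCount (suc c))            ≡⟨ cong ℤ.-_ (sym (μ-squareFree c free)) ⟩
        ℤ.- μ (suc c)                                              ∎
    where open ≡-Reasoning

  μ-prime-*-∣ : ∀ c → suc p ∣ suc c → μ (suc p * suc c) ≡ ⁺ 0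
  μ-prime-*-∣ c p∣c = μ-square _ pp (*-monoʳ-∣ (suc p) p∣c)

∃-prime-divisor : ∀ n → ∃ λ p → Prime (suc p) × suc p ∣ suc (suc n)
∃-prime-divisor n with factorise (suc (suc n))
... | record { factors = [] ; isFactorisation = () }
... | record { factors = zero ∷ _ ; factorsPrime = p ∷ _ } = contradiction refl (ℕ.≢-nonZero⁻¹ 0 {{prime⇒nonZero p}})
... | record { factors = suc p ∷ ps ; isFactorisation = eq ; factorsPrime = pp ∷ _ } =
  p , pp , divides (product ps) (trans eq (*-comm (suc p) (product ps)))

μ-sum : ℕ → ℤ
μ-sum n = ℤ∑.sum {n} (λ i → ⁺ ⟦ suc (toℕ i) ∣? n ⟧ ℤ.* μ (suc (toℕ i)))

-- For a prime p dividing the number m = p c, a divisor e prime to p is paired with p e, and μ (p e)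
-- = - μ e. The remaining divisors are those p e with p ∣ e, on which μ vanishes. Divisors prime to
-- p already divide c, so both halves become sums over 1, ..., c and cancel term by term.
μ-sum≡0 : ∀ n → μ-sum (suc (suc n)) ≡ ⁺ 0
μ-sum≡0 n with ∃-prime-divisor n
... | p , pp , divides c n≡cp = begin
  μ-sum (2 + n)                     ≡⟨ cong μ-sum (trans n≡cp (*-comm c (suc p))) ⟩
  ℤ∑.sum {m} (λ i → term (suc (toℕ i)))   ≡⟨ ℤ∑.sum-cong-≗ {m} (λ i → split (suc (toℕ i))) ⟩
  ℤ∑.sum {m} (λ i → coprime (suc (toℕ i)) ℤ.+ multiple (suc (toℕ i)))
    ≡⟨ ℤ∑.∑-distrib-+ {m} (coprime ∘ suc ∘ toℕ) (multiple ∘ suc ∘ toℕ) ⟩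
  ℤ∑.sum {m} (coprime ∘ suc ∘ toℕ) ℤ.+ ℤ∑.sum {m} (multiple ∘ suc ∘ toℕ)
    ≡⟨ cong₂ ℤ._+_ (sym (ℤ∑′.sum-extend (m≤n*m c (suc p)) (coprime ∘ suc) beyond))
                   (sym (ℤ∑′.sum-multiples p c multiple multiple-zero)) ⟩
  ℤ∑.sum {c} (coprime ∘ suc ∘ toℕ) ℤ.+ ℤ∑.sum {c} (λ j → multiple (suc p * suc (toℕ j)))
    ≡⟨ sym (ℤ∑.∑-distrib-+ {c} (coprime ∘ suc ∘ toℕ) (λ j → multiple (suc p * suc (toℕ j)))) ⟩
  ℤ∑.sum {c} (λ j → coprime (suc (toℕ j)) ℤ.+ multiple (suc p * suc (toℕ j)))
    ≡⟨ ℤ∑′.sum-zero {c} _ (λ j → cancel (toℕ j)) ⟩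
  ⁺ 0 ∎
  where
  open ≡-Reasoning
  m : ℕ
  m = suc p * c
  term coprime multiple : ℕ → ℤ
  term e = ⁺ ⟦ e ∣? m ⟧ ℤ.* μ e
  coprime e = ⁺ ⟦ ¬? (suc p ∣? e) ×-dec (e ∣? m) ⟧ ℤ.* μ e
  multiple e = ⁺ ⟦ (suc p ∣? e) ×-dec (e ∣? m) ⟧ ℤ.* μ e
  split : ∀ e → term e ≡ coprime e ℤ.+ multiple e
  split e = begin
    ⁺ ⟦ e ∣? m ⟧ ℤ.* μ e
      ≡⟨ cong (λ x → ⁺ x ℤ.* μ e) (⟦⟧-⊎ (e ∣? m) (¬? (suc p ∣? e) ×-dec (e ∣? m)) ((suc p ∣? e) ×-dec (e ∣? m))
           cases proj₂ proj₂ (λ ((¬a , _) , (a , _)) → ¬a a)) ⟩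
    ⁺ (⟦ ¬? (suc p ∣? e) ×-dec (e ∣? m) ⟧ + ⟦ (suc p ∣? e) ×-dec (e ∣? m) ⟧) ℤ.* μ e
      ≡⟨ ℤₚ.*-distribʳ-+ (μ e) (⁺ ⟦ ¬? (suc p ∣? e) ×-dec (e ∣? m) ⟧) (⁺ ⟦ (suc p ∣? e) ×-dec (e ∣? m) ⟧) ⟩
    coprime e ℤ.+ multiple e ∎
    where
    cases : e ∣ m → (¬ suc p ∣ e × e ∣ m) ⊎ (suc p ∣ e × e ∣ m)
    cases e∣m with suc p ∣? e
    ... | yes p∣e = inj₂ (p∣e , e∣m)
    ... | no  p∤e = inj₁ (p∤e , e∣m)
  zero-term : {P : Set} (d : Dec P) (e : ℕ) → ¬ P → ⁺ ⟦ d ⟧ ℤ.* μ e ≡ ⁺ 0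
  zero-term d e ¬P = trans (cong (λ x → ⁺ x ℤ.* μ e) (⟦⟧-no d ¬P)) (ℤₚ.*-zeroˡ (μ e))
  multiple-zero : ∀ e → ¬ suc p ∣ e → multiple e ≡ ⁺ 0
  multiple-zero e p∤e = zero-term ((suc p ∣? e) ×-dec (e ∣? m)) e (p∤e ∘ proj₁)
  coprime⇒∣ : ∀ {e} → ¬ suc p ∣ e → e ∣ m → e ∣ c
  coprime⇒∣ {e} p∤e (divides f m≡fe) with euclidsLemma f e pp (subst (suc p ∣_) m≡fe (m∣m*n c))
  ... | inj₂ p∣e = contradiction p∣e p∤e
  ... | inj₁ (divides g refl) = divides g (*-cancelˡ-≡ _ _ (suc p) (trans m≡fe (regroup g (suc p) e)))
    where
    regroup : ∀ x y z → (x * y) * z ≡ y * (x * z)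
    regroup = solve-∀
  instance
    c≢0 : NonZero c
    c≢0 = ℕ.≢-nonZero (λ { refl → contradiction n≡cp λ () })
  beyond : ∀ e → c ≤ e → coprime (suc e) ≡ ⁺ 0
  beyond e c≤e = zero-term (¬? (suc p ∣? suc e) ×-dec (suc e ∣? m)) (suc e)
    (λ (p∤e , e∣m) → <⇒≱ (s≤s c≤e) (∣⇒≤ (coprime⇒∣ p∤e e∣m)))
  cancel : ∀ j → coprime (suc j) ℤ.+ multiple (suc p * suc j) ≡ ⁺ 0
  cancel j = byCases (suc p ∣? suc j)
    where
    I : ℕ → ℤ
    I e = ⁺ ⟦ e ∣? m ⟧
    byCases : Dec (suc p ∣ suc j) → coprime (suc j) ℤ.+ multiple (suc p * suc j) ≡ ⁺ 0
    byCases (yes p∣j) = cong₂ ℤ._+_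
      (zero-term (¬? (suc p ∣? suc j) ×-dec (suc j ∣? m)) (suc j) (λ (p∤j , _) → p∤j p∣j))
      (trans (cong (⁺ ⟦ (suc p ∣? (suc p * suc j)) ×-dec ((suc p * suc j) ∣? m) ⟧ ℤ.*_) (μ-prime-*-∣ pp j p∣j))
        (ℤₚ.*-zeroʳ (⁺ ⟦ (suc p ∣? (suc p * suc j)) ×-dec ((suc p * suc j) ∣? m) ⟧)))
    byCases (no p∤j) = begin
      coprime (suc j) ℤ.+ multiple (suc p * suc j)
        ≡⟨ cong₂ ℤ._+_
             (cong (λ x → ⁺ x ℤ.* μ (suc j)) (⟦⟧-cong (¬? (suc p ∣? suc j) ×-dec (suc j ∣? m)) (suc j ∣? m) proj₂ (p∤j ,_)))
             (cong₂ (λ x y → ⁺ x ℤ.* y)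
               (⟦⟧-cong ((suc p ∣? (suc p * suc j)) ×-dec ((suc p * suc j) ∣? m)) (suc j ∣? m)
                 (λ (_ , pj∣m) → ∣-trans (n∣m*n (suc p)) pj∣m)
                 (λ j∣m → m∣m*n (suc j) , *-monoʳ-∣ (suc p) (coprime⇒∣ p∤j j∣m)))
               (μ-prime-* pp j p∤j)) ⟩
      I (suc j) ℤ.* μ (suc j) ℤ.+ I (suc j) ℤ.* (ℤ.- μ (suc j))
        ≡⟨ sym (ℤₚ.*-distribˡ-+ (I (suc j)) (μ (suc j)) (ℤ.- μ (suc j))) ⟩
      I (suc j) ℤ.* (μ (suc j) ℤ.+ ℤ.- μ (suc j))
        ≡⟨ cong (I (suc j) ℤ.*_) (ℤₚ.+-inverseʳ (μ (suc j))) ⟩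
      I (suc j) ℤ.* ⁺ 0
        ≡⟨ ℤₚ.*-zeroʳ (I (suc j)) ⟩
      ⁺ 0 ∎

-- The number of orbits of each size

pos-sum : (f : Fin n → ℕ) → ⁺ (sum f) ≡ ℤ∑.sum (λ i → ⁺ (f i))
pos-sum {zero}  f = refl
pos-sum {suc n} f = trans (ℤₚ.pos-+ (f zero) (sum (f ∘ suc))) (cong (ℤ._+_ (⁺ (f zero))) (pos-sum (f ∘ suc)))

div-multiple : ∀ q e .{{_ : NonZero e}} → (q * e) div e ≡ q
div-multiple q (suc e) = DM.m*n/n≡m q (suc e)

∣-div⁻ : ∀ {d e p} .{{_ : NonZero e}} → e ∣ d → p ∣ d div e → e * p ∣ d
∣-div⁻ {e = e} {p} (divides q refl) p∣ = subst (_∣ q * e) (*-comm p e)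
  (*-monoˡ-∣ e (subst (p ∣_) (div-multiple q e) p∣))

∣-div⁺ : ∀ {d e p} .{{_ : NonZero e}} → e * p ∣ d → e ∣ d × p ∣ d div e
∣-div⁺ {e = e} {p} (divides r refl) = divides (r * p) d≡ , subst (p ∣_) (sym (trans (cong (_div e) d≡) (div-multiple (r * p) e))) (n∣m*n r)
  where
  d≡ : r * (e * p) ≡ (r * p) * e
  d≡ = trans (cong (r *_) (*-comm e p)) (sym (*-assoc r p e))

-- Both sides say that e * p divides d. This symmetry is what allows the double sum over divisors
-- and points to be exchanged.
∣-div-swap : ∀ {d e p} .{{_ : NonZero e}} .{{_ : NonZero p}} → e ∣ d × p ∣ d div e → p ∣ d × e ∣ d div p
∣-div-swap {d} {e} {p} (e∣d , p∣) = ∣-div⁺ (subst (_∣ d) (*-comm e p) (∣-div⁻ e∣d p∣))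

module NecklaceCount (k′ L : ℕ) (2+L≡2^k : 2 + L ≡ 2 ^ suc k′) where

  open Doubling k′ L 2+L≡2^k
  open Orbits double k′ double^k

  private
    fixed : ℕ → ℕ
    fixed q = # (λ v → iter double q v Finₚ.≟ v)

    zero-coefficient : {P : Set} (d : Dec P) (x : ℤ) → ¬ P → ⁺ ⟦ d ⟧ ℤ.* x ≡ ⁺ 0
    zero-coefficient d x ¬P = trans (cong (λ y → ⁺ y ℤ.* x) (⟦⟧-no d ¬P)) (ℤₚ.*-zeroˡ x)

    2^-2 : ∀ q → suc q ∣ suc k′ → ⁺ (2 ^ suc q) ℤ.- ⁺ 2 ≡ ⁺ (fixed (suc q))
    2^-2 q q∣k = begin
      ⁺ (2 ^ suc q) ℤ.- ⁺ 2   ≡⟨ ℤₚ.m-n≡m⊖n (2 ^ suc q) 2 ⟩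
      2 ^ suc q ℤ.⊖ 2         ≡⟨ ℤₚ.⊖-≥ (*-monoʳ-≤ 2 (m^n>0 2 q)) ⟩
      ⁺ (2 ^ suc q ∸ 2)       ≡⟨ cong ⁺_ (sym (double-fixed-count (suc q) q∣k)) ⟩
      ⁺ (fixed (suc q))       ∎
      where open ≡-Reasoning

  module _ (d : ℕ) .{{_ : NonZero d}} (d∣k : d ∣ suc k′) where

    private
      properTerm allTerm : ℕ → ℤ
      properTerm e = ⁺ ⟦ (e ∣? d) ×-dec (e <? d) ⟧ ℤ.* (μ e ℤ.* (⁺ (2 ^ (d div e)) ℤ.- ⁺ 2))
      allTerm e = ⁺ ⟦ e ∣? d ⟧ ℤ.* (μ e ℤ.* ⁺ (fixed (d div e)))

      -- The divisor e = d may be added to the sum since 2 ^ 1 - 2 = 0.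
      proper≡all : ∀ e .{{_ : NonZero e}} → properTerm e ≡ allTerm e
      proper≡all e = byCases (e ∣? d) (e <? d)
        where
        byCases : Dec (e ∣ d) → Dec (e < d) → properTerm e ≡ allTerm e
        byCases (no e∤d) _ = trans (zero-coefficient ((e ∣? d) ×-dec (e <? d)) _ (e∤d ∘ proj₁)) (sym (zero-coefficient (e ∣? d) _ e∤d))
        byCases (yes e∣d@(divides zero d≡)) _ = contradiction d≡ (ℕ.≢-nonZero⁻¹ d)
        byCases (yes e∣d@(divides (suc q) d≡)) (yes e<d) = cong₂ (λ x y → ⁺ x ℤ.* (μ e ℤ.* y))
          (⟦⟧-cong ((e ∣? d) ×-dec (e <? d)) (e ∣? d) proj₁ (_, e<d))
          (begin
            ⁺ (2 ^ (d div e)) ℤ.- ⁺ 2 ≡⟨ cong (λ x → ⁺ (2 ^ x) ℤ.- ⁺ 2) d/e ⟩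
            ⁺ (2 ^ suc q) ℤ.- ⁺ 2     ≡⟨ 2^-2 q (∣-trans (divides e (trans d≡ (*-comm (suc q) e))) d∣k) ⟩
            ⁺ fixed (suc q)           ≡⟨ cong (⁺_ ∘ fixed) (sym d/e) ⟩
            ⁺ fixed (d div e)         ∎)
          where
          open ≡-Reasoning
          d/e : d div e ≡ suc q
          d/e = trans (cong (_div e) d≡) (div-multiple (suc q) e)
        byCases (yes e∣d) (no e≮d) = trans (zero-coefficient ((e ∣? d) ×-dec (e <? d)) _ (e≮d ∘ proj₂)) (sym (begin
          ⁺ ⟦ e ∣? d ⟧ ℤ.* (μ e ℤ.* ⁺ fixed (d div e)) ≡⟨ cong (λ x → ⁺ ⟦ e ∣? d ⟧ ℤ.* (μ e ℤ.* ⁺ (fixed x))) d/e ⟩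
          ⁺ ⟦ e ∣? d ⟧ ℤ.* (μ e ℤ.* ⁺ fixed 1)         ≡⟨ cong (λ x → ⁺ ⟦ e ∣? d ⟧ ℤ.* (μ e ℤ.* ⁺ x)) (double-fixed-count 1 (1∣ suc k′)) ⟩
          ⁺ ⟦ e ∣? d ⟧ ℤ.* (μ e ℤ.* ⁺ 0)               ≡⟨ cong (⁺ ⟦ e ∣? d ⟧ ℤ.*_) (ℤₚ.*-zeroʳ (μ e)) ⟩
          ⁺ ⟦ e ∣? d ⟧ ℤ.* ⁺ 0                         ≡⟨ ℤₚ.*-zeroʳ (⁺ ⟦ e ∣? d ⟧) ⟩
          ⁺ 0                                          ∎))
          where
          open ≡-Reasoning
          d/e : d div e ≡ 1
          d/e = trans (cong (_div e) (trans (≤-antisym (≮⇒≥ e≮d) (∣⇒≤ e∣d)) (sym (*-identityˡ e)))) (div-multiple 1 e)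

      pairTerm : Fin L → ℕ → ℤ
      pairTerm v e = ⁺ ⟦ per v ∣? d ⟧ ℤ.* (⁺ ⟦ e ∣? d div per v ⟧ ℤ.* μ e)

      -- A point is fixed by `d div e` doublings iff its period divides `d div e`. The conditions on
      -- e and on the period are then traded by `∣-div-swap`, so that v can be held fixed while e
      -- runs over the divisors of `d div per v`.
      all≡pairs : ∀ e .{{_ : NonZero e}} → allTerm e ≡ ℤ∑.sum (λ v → pairTerm v e)
      all≡pairs e = begin
        I ℤ.* (μ e ℤ.* ⁺ fixed (d div e))
          ≡⟨ cong (λ x → I ℤ.* (μ e ℤ.* ⁺ x))
               (#-cong (λ v → iter double (d div e) v Finₚ.≟ v) (λ v → per v ∣? d div e) (λ v → per-∣ v (d div e)) (λ v → ∣-per v)) ⟩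
        I ℤ.* (μ e ℤ.* ⁺ # (λ v → per v ∣? d div e))
          ≡⟨ cong (λ x → I ℤ.* (μ e ℤ.* x)) (pos-sum (λ v → ⟦ per v ∣? d div e ⟧)) ⟩
        I ℤ.* (μ e ℤ.* ℤ∑.sum J)
          ≡⟨ cong (I ℤ.*_) (ℤ∑.*-distribˡ-sum (μ e) J) ⟩
        I ℤ.* ℤ∑.sum (λ v → μ e ℤ.* J v)
          ≡⟨ ℤ∑.*-distribˡ-sum I (λ v → μ e ℤ.* J v) ⟩
        ℤ∑.sum (λ v → I ℤ.* (μ e ℤ.* J v))
          ≡⟨ ℤ∑.sum-cong-≗ swap ⟩
        ℤ∑.sum (λ v → pairTerm v e) ∎
        where
        open ≡-Reasoning
        I : ℤ
        I = ⁺ ⟦ e ∣? d ⟧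
        J : Fin L → ℤ
        J v = ⁺ ⟦ per v ∣? d div e ⟧
        swap : ∀ v → I ℤ.* (μ e ℤ.* J v) ≡ pairTerm v e
        swap v = begin
          I ℤ.* (μ e ℤ.* J v)                               ≡⟨ cong (I ℤ.*_) (ℤₚ.*-comm (μ e) (J v)) ⟩
          I ℤ.* (J v ℤ.* μ e)                               ≡⟨ sym (ℤₚ.*-assoc I (J v) (μ e)) ⟩
          I ℤ.* J v ℤ.* μ e                                 ≡⟨ cong (ℤ._* μ e) (sym (ℤₚ.pos-* ⟦ e ∣? d ⟧ ⟦ per v ∣? d div e ⟧)) ⟩
          ⁺ (⟦ e ∣? d ⟧ * ⟦ per v ∣? d div e ⟧) ℤ.* μ e     ≡⟨ cong (λ x → ⁺ x ℤ.* μ e) (begin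
            ⟦ e ∣? d ⟧ * ⟦ per v ∣? d div e ⟧             ≡⟨ sym (⟦⟧-× (e ∣? d) (per v ∣? d div e)) ⟩
            ⟦ (e ∣? d) ×-dec (per v ∣? d div e) ⟧         ≡⟨ ⟦⟧-cong ((e ∣? d) ×-dec (per v ∣? d div e))
                                                                       ((per v ∣? d) ×-dec (e ∣? d div per v)) ∣-div-swap ∣-div-swap ⟩
            ⟦ (per v ∣? d) ×-dec (e ∣? d div per v) ⟧     ≡⟨ ⟦⟧-× (per v ∣? d) (e ∣? d div per v) ⟩
            ⟦ per v ∣? d ⟧ * ⟦ e ∣? d div per v ⟧         ∎) ⟩
          ⁺ (⟦ per v ∣? d ⟧ * ⟦ e ∣? d div per v ⟧) ℤ.* μ e ≡⟨ cong (ℤ._* μ e) (ℤₚ.pos-* ⟦ per v ∣? d ⟧ ⟦ e ∣? d div per v ⟧) ⟩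
          ⁺ ⟦ per v ∣? d ⟧ ℤ.* ⁺ ⟦ e ∣? d div per v ⟧ ℤ.* μ e ≡⟨ ℤₚ.*-assoc (⁺ ⟦ per v ∣? d ⟧) (⁺ ⟦ e ∣? d div per v ⟧) (μ e) ⟩
          pairTerm v e                                      ∎

      -- For fixed v the inner sum is that of μ over the divisors of the quotient d / per v, which
      -- vanishes unless the quotient is 1.
      möbius-inversion : ∀ v → ℤ∑.sum {d} (λ i → pairTerm v (suc (toℕ i))) ≡ ⁺ ⟦ per v ℕ.≟ d ⟧
      möbius-inversion v = trans (sym (ℤ∑.*-distribˡ-sum {d} (⁺ ⟦ per v ∣? d ⟧) (λ i → term (suc (toℕ i))))) (byCases (per v ∣? d))
        where
        open ≡-Reasoning
        term : ℕ → ℤ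
        term e = ⁺ ⟦ e ∣? d div per v ⟧ ℤ.* μ e
        byCases : Dec (per v ∣ d) → ⁺ ⟦ per v ∣? d ⟧ ℤ.* ℤ∑.sum {d} (λ i → term (suc (toℕ i))) ≡ ⁺ ⟦ per v ℕ.≟ d ⟧
        byCases (no p∤d) = trans (zero-coefficient (per v ∣? d) _ p∤d)
          (cong ⁺_ (sym (⟦⟧-no (per v ℕ.≟ d) λ eq → p∤d (subst (per v ∣_) eq ∣-refl))))
        byCases (yes p∣d@(divides q d≡)) = begin
          ⁺ ⟦ per v ∣? d ⟧ ℤ.* ℤ∑.sum {d} (λ i → term (suc (toℕ i)))
            ≡⟨ cong (λ x → ⁺ x ℤ.* ℤ∑.sum {d} (λ i → term (suc (toℕ i)))) (⟦⟧-yes (per v ∣? d) p∣d) ⟩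
          ⁺ 1 ℤ.* ℤ∑.sum {d} (λ i → term (suc (toℕ i)))
            ≡⟨ ℤₚ.*-identityˡ (ℤ∑.sum {d} (λ i → term (suc (toℕ i)))) ⟩
          ℤ∑.sum {d} (λ i → term (suc (toℕ i)))
            ≡⟨ ℤ∑.sum-cong-≗ {d} (λ i → cong (λ x → ⁺ ⟦ suc (toℕ i) ∣? x ⟧ ℤ.* μ (suc (toℕ i))) d/p) ⟩
          ℤ∑.sum {d} (λ i → ⁺ ⟦ suc (toℕ i) ∣? q ⟧ ℤ.* μ (suc (toℕ i)))
            ≡⟨ sym (ℤ∑′.sum-extend q≤d (λ e → ⁺ ⟦ suc e ∣? q ⟧ ℤ.* μ (suc e)) (λ e q≤e →
                 zero-coefficient (suc e ∣? q) (μ (suc e)) λ e∣q → <⇒≱ (s≤s q≤e) (∣⇒≤ {{q≢0}} e∣q))) ⟩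
          μ-sum q
            ≡⟨ evaluate q d≡ ⟩
          ⁺ ⟦ per v ℕ.≟ d ⟧ ∎
          where
          d/p : d div per v ≡ q
          d/p = trans (cong (_div per v) d≡) (div-multiple q (per v))
          q≤d : q ≤ d
          q≤d = subst (q ≤_) (sym d≡) (m≤m*n q (per v))
          q≢0 : NonZero q
          q≢0 = ℕ.≢-nonZero λ { refl → ℕ.≢-nonZero⁻¹ d d≡ }
          evaluate : ∀ q → d ≡ q * per v → μ-sum q ≡ ⁺ ⟦ per v ℕ.≟ d ⟧
          evaluate zero          d≡ = contradiction d≡ (ℕ.≢-nonZero⁻¹ d)
          -- `μ-sum 1` computes to 1.
          evaluate (suc zero)    d≡ = cong ⁺_ (sym (⟦⟧-yes (per v ℕ.≟ d) (sym (trans d≡ (*-identityˡ (per v))))))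
          evaluate (suc (suc q)) d≡ = trans (μ-sum≡0 q) (cong ⁺_ (sym (⟦⟧-no (per v ℕ.≟ d) λ p≡d →
            <⇒≢ (m<m+n (per v) (s≤s z≤n)) (trans p≡d d≡))))

    Nsum-period : Nsum d ≡ ⁺ # (λ v → per v ℕ.≟ d)
    Nsum-period = begin
      Nsum d
        ≡⟨ sum-filter-upTo (λ e → (e ∣? d) ×-dec (e <? d)) (λ e → μ e ℤ.* (⁺ (2 ^ (d div e)) ℤ.- ⁺ 2)) d ⟩
      ℤ∑.sum {d} (λ i → properTerm (suc (toℕ i)))
        ≡⟨ ℤ∑.sum-cong-≗ {d} (λ i → trans (proper≡all (suc (toℕ i))) (all≡pairs (suc (toℕ i)))) ⟩
      ℤ∑.sum {d} (λ i → ℤ∑.sum (λ v → pairTerm v (suc (toℕ i))))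
        ≡⟨ ℤ∑.∑-comm {d} (λ i v → pairTerm v (suc (toℕ i))) ⟩
      ℤ∑.sum (λ v → ℤ∑.sum {d} (λ i → pairTerm v (suc (toℕ i))))
        ≡⟨ ℤ∑.sum-cong-≗ möbius-inversion ⟩
      ℤ∑.sum (λ v → ⁺ ⟦ per v ℕ.≟ d ⟧)
        ≡⟨ sym (pos-sum (λ v → ⟦ per v ℕ.≟ d ⟧)) ⟩
      ⁺ # (λ v → per v ℕ.≟ d) ∎
      where open ≡-Reasoning

    -- The sum counts points lying on orbits of size d; this is what makes it nonnegative and the
    -- division in `N` exact.
    N-repsOfPeriod : N d ≡ # (isRepOfPeriod? d)
    N-repsOfPeriod = begin
      ℤ.∣ Nsum d ∣ div d                      ≡⟨ cong (λ x → ℤ.∣ x ∣ div d) Nsum-period ⟩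
      # (λ v → per v ℕ.≟ d) div d             ≡⟨ cong (_div d) (period-count d) ⟩
      (# (isRepOfPeriod? d) * d) div d        ≡⟨ div-multiple (# (isRepOfPeriod? d)) d ⟩
      # (isRepOfPeriod? d)                    ∎
      where open ≡-Reasoning

-- Standardization and sorted sequences

-- The lexicographic order of the pairs (y i, i), in which a stable sort lists the positions.
Before : (Fin n → ℕ) → Fin n → Fin n → Set
Before y i j = y i < y j ⊎ (y i ≡ y j × toℕ i < toℕ j)

module Standardization {n} (y : Fin n → ℕ) where

  before? : ∀ i j → Dec (Before y i j)
  before? i j = (y i <? y j) ⊎-dec ((y i ℕ.≟ y j) ×-dec (toℕ i <? toℕ j))

  before-irrefl : ∀ i → ¬ Before y i i
  before-irrefl i (inj₁ lt)       = <-irrefl refl lt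
  before-irrefl i (inj₂ (_ , lt)) = <-irrefl refl lt

  before-trans : ∀ {i j l} → Before y i j → Before y j l → Before y i l
  before-trans (inj₁ lt)        (inj₁ lt′)         = inj₁ (<-trans lt lt′)
  before-trans (inj₁ lt)        (inj₂ (eq′ , _))   = inj₁ (<-≤-trans lt (≤-reflexive eq′))
  before-trans (inj₂ (eq , _))  (inj₁ lt′)         = inj₁ (≤-<-trans (≤-reflexive eq) lt′)
  before-trans (inj₂ (eq , lt)) (inj₂ (eq′ , lt′)) = inj₂ (trans eq eq′ , <-trans lt lt′)

  before-total : ∀ {i j} → i ≢ j → Before y i j ⊎ Before y j i
  before-total {i} {j} i≢j with <-cmp (y i) (y j) | <-cmp (toℕ i) (toℕ j)
  ... | tri< lt _ _ | _            = inj₁ (inj₁ lt)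
  ... | tri> _ _ gt | _            = inj₂ (inj₁ gt)
  ... | tri≈ _ eq _ | tri< lt _ _  = inj₁ (inj₂ (eq , lt))
  ... | tri≈ _ eq _ | tri> _ _ gt  = inj₂ (inj₂ (sym eq , gt))
  ... | tri≈ _ eq _ | tri≈ _ i≡j _ = contradiction (Finₚ.toℕ-injective i≡j) i≢j

  rank : Fin n → ℕ
  rank i = # (λ j → before? j i)

  rank-mono : ∀ {i j} → Before y i j → rank i < rank j
  rank-mono {i} {j} b = #-< (λ l → before? l i) (λ l → before? l j) (λ l b′ → before-trans b′ b) i (before-irrefl i) b

  rank<n : ∀ i → rank i < n
  rank<n i = <-≤-trans (#-< (λ l → before? l i) (λ l → toℕ l <? n) (λ l _ → Finₚ.toℕ<n l) i (before-irrefl i) (Finₚ.toℕ<n i))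
    (≤-reflexive (#-below ≤-refl))

  abstract
    std : Fin n → Fin n
    std i = fromℕ< (rank<n i)

    toℕ-std : ∀ i → toℕ (std i) ≡ rank i
    toℕ-std i = Finₚ.toℕ-fromℕ< (rank<n i)

  std-mono : ∀ {i j} → Before y i j → toℕ (std i) < toℕ (std j)
  std-mono b = subst₂ _<_ (sym (toℕ-std _)) (sym (toℕ-std _)) (rank-mono b)

  -- An order-preserving bijection carries the positions before `i` onto the values below `π i`, and
  -- there are exactly `π i` of those; `rank i` is therefore forced.
  std-unique : (π : Fin n → Fin n) → (∀ {i j} → π i ≡ π j → i ≡ j) → (∀ v → ∃ λ i → π i ≡ v) →
               (∀ {i j} → Before y i j → toℕ (π i) < toℕ (π j)) → ∀ i → std i ≡ π i
  std-unique π inj surj mono i = Finₚ.toℕ-injective (begin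
    toℕ (std i)                              ≡⟨ toℕ-std i ⟩
    # (λ j → before? j i)                    ≡⟨ #-cong (λ j → before? j i) (λ j → toℕ (π j) <? toℕ (π i)) (λ _ → mono) reflects ⟩
    # (λ j → toℕ (π j) <? toℕ (π i))         ≡⟨ sum-image π inj (λ v → ⟦ toℕ v <? toℕ (π i) ⟧)
                                                  (λ v miss → let (j , eq) = surj v in contradiction eq (miss j)) ⟩
    # {n} (λ v → toℕ v <? toℕ (π i))           ≡⟨ #-below (<⇒≤ (Finₚ.toℕ<n (π i))) ⟩
    toℕ (π i)                                ∎)
    where
    open ≡-Reasoning
    reflects : ∀ j → toℕ (π j) < toℕ (π i) → Before y j i
    reflects j lt with j Finₚ.≟ i
    ... | yes refl = contradiction lt (<-irrefl refl)
    ... | no  j≢i with before-total j≢i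
    ...   | inj₁ b = b
    ...   | inj₂ b = contradiction (mono b) (<-asym lt)

Sorted : (Fin n → ℕ) → Set
Sorted x = ∀ {i j} → toℕ i ≤ toℕ j → x i ≤ x j

module _ {x : Fin n → ℕ} (sorted : Sorted x) where

  -- In a sorted sequence the entries below `v` fill an initial segment, so their number is the
  -- position at which the segment ends. With its converse this turns comparisons of entries into
  -- comparisons of counts.
  sorted-below⁺ : ∀ l v → x l < v → toℕ l < # (λ j → x j <? v)
  sorted-below⁺ l v xl<v = subst (_≤ # (λ j → x j <? v)) (#-below (Finₚ.toℕ<n l))
    (#-mono (λ j → toℕ j <? suc (toℕ l)) (λ j → x j <? v) (λ { j (s≤s j≤l) → ≤-<-trans (sorted j≤l) xl<v }))

  sorted-below⁻ : ∀ l v → toℕ l < # (λ j → x j <? v) → x l < v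
  sorted-below⁻ l v l< = ≰⇒> λ v≤xl → <⇒≱ l< (subst (# (λ j → x j <? v) ≤_) (#-below (<⇒≤ (Finₚ.toℕ<n l)))
    (#-mono (λ j → x j <? v) (λ j → toℕ j <? toℕ l) (λ j xj<v → ≰⇒> λ l≤j → <⇒≱ xj<v (≤-trans v≤xl (sorted l≤j)))))

#-<suc : (x : Fin n → ℕ) → ∀ v → # (λ j → x j <? suc v) ≡ # (λ j → x j <? v) + # (λ j → x j ℕ.≟ v)
#-<suc x v = #-⊎ (λ j → x j <? v) (λ j → x j ℕ.≟ v) (λ j → x j <? suc v)
  (λ { j (s≤s le) → m≤n⇒m<n∨m≡n le }) (λ j → m<n⇒m<1+n) (λ j → s≤s ∘ ≤-reflexive) (λ { j (lt , refl) → <-irrefl refl lt })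

SameCounts : (x y : Fin n → ℕ) → Set
SameCounts x y = ∀ v → # (λ j → x j ℕ.≟ v) ≡ # (λ j → y j ℕ.≟ v)

sameCounts-below : (x y : Fin n → ℕ) → SameCounts x y → ∀ v → # (λ j → x j <? v) ≡ # (λ j → y j <? v)
sameCounts-below x y same zero    = trans (#-none (λ j → x j <? 0) (λ _ ())) (sym (#-none (λ j → y j <? 0) (λ _ ())))
sameCounts-below x y same (suc v) = trans (#-<suc x v)
  (trans (cong₂ _+_ (sameCounts-below x y same v) (same v)) (sym (#-<suc y v)))

-- Whether the l-th entry is below v depends only on how many entries are below v, and these numbers
-- follow from the counts.
sorted-unique : (x y : Fin n → ℕ) → Sorted x → Sorted y → SameCounts x y → ∀ l → x l ≡ y l
sorted-unique x y sx sy same l = ≤-antisym (half x y sx sy same) (half y x sy sx (sym ∘ same))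
  where
  half : (x y : Fin _ → ℕ) → Sorted x → Sorted y → SameCounts x y → x l ≤ y l
  half x y sx sy same = ℕ.s≤s⁻¹ (sorted-below⁻ sx l (suc (y l))
    (subst (toℕ l <_) (sym (sameCounts-below x y same (suc (y l)))) (sorted-below⁺ sy l (suc (y l)) ≤-refl)))

-- The rank of i is at least the number of entries of `y` below `y i` and less than the number of
-- those at most `y i`. The sorted `x` has the same two numbers, so its entry at that position is
-- `y i`.
sort-std : (x y : Fin n → ℕ) → Sorted x → SameCounts x y → ∀ i → x (Standardization.std y i) ≡ y i
sort-std x y sorted same i = ≤-antisym
  (ℕ.s≤s⁻¹ (sorted-below⁻ sorted (std i) (suc (y i)) (subst₂ _<_ (sym (toℕ-std i)) (sym (sameCounts-below x y same (suc (y i))))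
    (#-< (λ j → before? j i) (λ j → y j <? suc (y i)) (λ { j (inj₁ lt) → m<n⇒m<1+n lt ; j (inj₂ (eq , _)) → s≤s (≤-reflexive eq) })
      i (before-irrefl i) ≤-refl))))
  (≮⇒≥ λ x<y → <⇒≱ (sorted-below⁺ sorted (std i) (y i) x<y)
    (subst₂ _≤_ (sym (sameCounts-below x y same (y i))) (sym (toℕ-std i))
      (#-mono (λ j → y j <? y i) (λ j → before? j i) (λ j → inj₁))))
  where open Standardization y

prefix : (Fin L → ℕ) → ℕ → ℕ
prefix {zero}  f v       = 0
prefix {suc L} f zero    = 0
prefix {suc L} f (suc v) = f zero + prefix (f ∘ suc) v

prefix-suc : (f : Fin L → ℕ) → ∀ v → prefix f (suc (toℕ v)) ≡ prefix f (toℕ v) + f v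
prefix-suc {suc zero}    f zero    = +-identityʳ (f zero)
prefix-suc {suc (suc L)} f zero    = +-identityʳ (f zero)
prefix-suc {suc (suc L)} f (suc v) = trans (cong (f zero +_) (prefix-suc (f ∘ suc) v)) (sym (+-assoc (f zero) _ _))

prefix-≤-sum : (f : Fin L → ℕ) → ∀ v → prefix f v ≤ sum f
prefix-≤-sum {zero}  f v       = z≤n
prefix-≤-sum {suc L} f zero    = z≤n
prefix-≤-sum {suc L} f (suc v) = +-monoʳ-≤ (f zero) (prefix-≤-sum (f ∘ suc) v)

-- The l-th entry of the sorted sequence in which each v occurs f v times.
locate : (f : Fin L → ℕ) → ∀ l → l < sum f → Fin L
locate {suc L} f l l< with l <? f zero
... | yes _ = zero
... | no l≮ = suc (locate (f ∘ suc) (l ∸ f zero) (+-cancelˡ-< (f zero) _ _ (subst (_< sum f) (sym (m+[n∸m]≡n (≮⇒≥ l≮))) l<)))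

-- With its converse this characterizes `locate`: an entry is below v iff its position is below the
-- v-th prefix sum. Sortedness and multiplicities both follow from the equivalence.
locate-<⁺ : (f : Fin L → ℕ) → ∀ l l< v → toℕ (locate f l l<) < v → l < prefix f v
locate-<⁺ {suc L} f l l< (suc v) lt with l <? f zero
... | yes l<f0 = <-≤-trans l<f0 (m≤m+n (f zero) _)
... | no  l≮   = subst (_< prefix f (suc v)) (m+[n∸m]≡n (≮⇒≥ l≮))
  (+-monoʳ-< (f zero) (locate-<⁺ (f ∘ suc) (l ∸ f zero) _ v (ℕ.s<s⁻¹ lt)))

locate-<⁻ : (f : Fin L → ℕ) → ∀ l l< v → l < prefix f v → toℕ (locate f l l<) < v
locate-<⁻ {suc L} f l l< (suc v) lt with l <? f zero
... | yes l<f0 = s≤s z≤n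
... | no  l≮   = s≤s (locate-<⁻ (f ∘ suc) (l ∸ f zero) _ v
  (+-cancelˡ-< (f zero) _ _ (subst (_< prefix f (suc v)) (sym (m+[n∸m]≡n (≮⇒≥ l≮))) lt)))

module Arrange (f : Fin L → ℕ) (Σf≡n : sum f ≡ n) where

  private
    bound : ∀ (l : Fin n) → toℕ l < sum f
    bound l = subst (toℕ l <_) (sym Σf≡n) (Finₚ.toℕ<n l)

  abstract
    arrange : Fin n → Fin L
    arrange l = locate f (toℕ l) (bound l)

    arrange-sorted : Sorted (toℕ ∘ arrange)
    arrange-sorted {i} {j} i≤j = ℕ.s≤s⁻¹ (locate-<⁻ f (toℕ i) (bound i) (suc (toℕ (arrange j)))
      (≤-<-trans i≤j (locate-<⁺ f (toℕ j) (bound j) (suc (toℕ (arrange j))) ≤-refl)))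

    arrange-below : ∀ v → # (λ l → toℕ (arrange l) <? v) ≡ prefix f v
    arrange-below v = trans
      (#-cong (λ l → toℕ (arrange l) <? v) (λ l → toℕ l <? prefix f v)
        (λ l → locate-<⁺ f (toℕ l) (bound l) v) (λ l → locate-<⁻ f (toℕ l) (bound l) v))
      (#-below (≤-trans (prefix-≤-sum f v) (≤-reflexive Σf≡n)))

  arrange-count : ∀ v → # (λ l → arrange l Finₚ.≟ v) ≡ f v
  arrange-count v = +-cancelˡ-≡ (prefix f (toℕ v)) _ _ (begin
    prefix f (toℕ v) + # (λ l → arrange l Finₚ.≟ v)
      ≡⟨ cong₂ _+_ (sym (arrange-below (toℕ v)))
           (#-cong (λ l → arrange l Finₚ.≟ v) (λ l → toℕ (arrange l) ℕ.≟ toℕ v) (λ l → cong toℕ) (λ l → Finₚ.toℕ-injective)) ⟩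
    # (λ l → toℕ (arrange l) <? toℕ v) + # (λ l → toℕ (arrange l) ℕ.≟ toℕ v)
      ≡⟨ sym (#-<suc (toℕ ∘ arrange) (toℕ v)) ⟩
    # (λ l → toℕ (arrange l) <? suc (toℕ v))
      ≡⟨ arrange-below (suc (toℕ v)) ⟩
    prefix f (suc (toℕ v))
      ≡⟨ prefix-suc f v ⟩
    prefix f (toℕ v) + f v ∎)
    where open ≡-Reasoning

toℕ-sameCounts : (x y : Fin n → Fin L) → (∀ v → # (λ j → x j Finₚ.≟ v) ≡ # (λ j → y j Finₚ.≟ v)) → SameCounts (toℕ ∘ x) (toℕ ∘ y)
toℕ-sameCounts {L = L} x y same v with v <? L
... | yes v<L = trans (convert x) (trans (same (fromℕ< v<L)) (sym (convert y)))
  where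
  convert : ∀ x → # (λ j → toℕ (x j) ℕ.≟ v) ≡ # (λ j → x j Finₚ.≟ fromℕ< v<L)
  convert x = #-cong (λ j → toℕ (x j) ℕ.≟ v) (λ j → x j Finₚ.≟ fromℕ< v<L)
    (λ j eq → Finₚ.toℕ-injective (trans eq (sym (Finₚ.toℕ-fromℕ< v<L))))
    (λ j eq → trans (cong toℕ eq) (Finₚ.toℕ-fromℕ< v<L))
... | no v≮L = trans (none x) (sym (none y))
  where
  none : ∀ x → # (λ j → toℕ (x j) ℕ.≟ v) ≡ 0
  none x = #-none (λ j → toℕ (x j) ℕ.≟ v) (λ { j refl → v≮L (Finₚ.toℕ<n (x j)) })

-- Itineraries

-- A point with `Q` would begin an endless chain i < p i < p (p i) < ⋯ in `Fin n`, where `_>_` is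
-- well-founded.
no-ascent : (p : Fin n → Fin n) (Q : Fin n → Set) → (∀ i → Q i → Q (p i) × toℕ i < toℕ (p i)) → ∀ i → ¬ Q i
no-ascent p Q step i = go i (FinInd.>-wellFounded i)
  where
  go : ∀ i → Acc Fin._>_ i → ¬ Q i
  go i (acc rs) Qi = let (Qpi , i<pi) = step i Qi in go (p i) (rs i<pi) Qpi

no-descent : (p : Fin n → Fin n) (Q : Fin n → Set) → (∀ i → Q i → Q (p i) × toℕ (p i) < toℕ i) → ∀ i → ¬ Q i
no-descent p Q step i = go i (FinInd.<-wellFounded i)
  where
  go : ∀ i → Acc Fin._<_ i → ¬ Q i
  go i (acc rs) Qi = let (Qpi , pi<i) = step i Qi in go (p i) (rs pi<i) Qpi

-- The common shape of the doubling map and of a fixed-point-free Grassmannian permutation: the points moved up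
-- form an initial segment.
record TwoRuns (p : Fin n → Fin n) : Set where
  field
    no-fix : ∀ i → p i ≢ i
    up     : ∀ {i j} → toℕ j < toℕ (p j) → toℕ i < toℕ j → toℕ i < toℕ (p i) × toℕ (p i) < toℕ (p j)
    down   : ∀ {i j} → toℕ (p i) < toℕ i → toℕ i < toℕ j → toℕ (p j) < toℕ j × toℕ (p i) < toℕ (p j)

  direction : ∀ i → toℕ i < toℕ (p i) ⊎ toℕ (p i) < toℕ i
  direction i with <-cmp (toℕ i) (toℕ (p i))
  ... | tri< lt _ _ = inj₁ lt
  ... | tri≈ _ eq _ = contradiction (sym (Finₚ.toℕ-injective eq)) (no-fix i)
  ... | tri> _ _ gt = inj₂ gt

module Itineraries (k′ L : ℕ) (2+L≡2^k : 2 + L ≡ 2 ^ suc k′) where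

  open Doubling k′ L 2+L≡2^k

  double-twoRuns : TwoRuns double
  double-twoRuns = record { no-fix = double-≢ ; up = double-up ; down = double-down }

  module Itinerary {n} (p : Fin n → Fin n) (runs : TwoRuns p) (p^k : ∀ i → iter p (suc k′) i ≡ i) where

    open TwoRuns runs

    letter : Fin n → ℕ
    letter i = ⟦ toℕ (p i) <? toℕ i ⟧

    letter-up : ∀ {i} → toℕ i < toℕ (p i) → letter i ≡ 0
    letter-up {i} lt = ⟦⟧-no (toℕ (p i) <? toℕ i) (<-asym lt)

    letter-down : ∀ {i} → toℕ (p i) < toℕ i → letter i ≡ 1
    letter-down {i} lt = ⟦⟧-yes (toℕ (p i) <? toℕ i) lt

    -- The binary number with digits letter i, letter (p i), …, letter (p ^ (r - 1) i).
    word : ℕ → Fin n → ℕ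
    word zero    i = 0
    word (suc r) i = letter i * 2 ^ r + word r (p i)

    word<2^ : ∀ r i → word r i < 2 ^ r
    word<2^ zero    i = s≤s z≤n
    word<2^ (suc r) i = begin-strict
      letter i * 2 ^ r + word r (p i)  <⟨ +-mono-≤-< (*-monoˡ-≤ (2 ^ r) (⟦⟧≤1 (toℕ (p i) <? toℕ i))) (word<2^ r (p i)) ⟩
      1 * 2 ^ r + 2 ^ r                ≡⟨ +-comm (1 * 2 ^ r) (2 ^ r) ⟩
      2 ^ suc r                        ∎
      where open ≤-Reasoning

    -- Points moved up precede points moved down, so for i < j the leading letters are equal or are
    -- 0 and 1. Equal letters leave the comparison to `p i` and `p j`, which are in the same order
    -- because `p` increases on each run. If they differ, the leading 1 outweighs all later digits
    -- by `word<2^`.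
    word-sorted : ∀ r → Sorted (word r)
    word-sorted zero    i≤j = z≤n
    word-sorted (suc r) {i} {j} i≤j with m≤n⇒m<n∨m≡n i≤j
    ... | inj₂ i≡j = ≤-reflexive (cong (word (suc r)) (Finₚ.toℕ-injective i≡j))
    ... | inj₁ i<j with direction i | direction j
    ...   | inj₂ dn | _ = let (dnj , lt) = down dn i<j in
            +-mono-≤ (≤-reflexive (cong (_* 2 ^ r) (trans (letter-down dn) (sym (letter-down dnj))))) (word-sorted r (<⇒≤ lt))
    ...   | inj₁ _  | inj₁ upj = let (upi , lt) = up upj i<j in
            +-mono-≤ (≤-reflexive (cong (_* 2 ^ r) (trans (letter-up upi) (sym (letter-up upj))))) (word-sorted r (<⇒≤ lt))
    ...   | inj₁ upi | inj₂ dnj = begin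
            letter i * 2 ^ r + word r (p i)   ≡⟨ cong (λ b → b * 2 ^ r + word r (p i)) (letter-up upi) ⟩
            word r (p i)                      ≤⟨ <⇒≤ (word<2^ r (p i)) ⟩
            2 ^ r                             ≡⟨ sym (*-identityˡ (2 ^ r)) ⟩
            1 * 2 ^ r                         ≡⟨ cong (_* 2 ^ r) (sym (letter-down dnj)) ⟩
            letter j * 2 ^ r                  ≤⟨ m≤m+n _ _ ⟩
            letter j * 2 ^ r + word r (p j)   ∎
      where open ≤-Reasoning

    -- The definition splits off the leading digit, this the last one. Comparing both for k + 1
    -- letters, the first and last of which agree by periodicity, gives `word-step`: moving along
    -- `p` rotates the word and doubles its value modulo `M`.
    word-snoc : ∀ r i → word (suc r) i ≡ 2 * word r i + letter (iter p r i)
    word-snoc zero    i = trans (+-identityʳ _) (*-identityʳ (letter i))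
    word-snoc (suc r) i = begin
      letter i * 2 ^ suc r + word (suc r) (p i)
        ≡⟨ cong (letter i * 2 ^ suc r +_) (word-snoc r (p i)) ⟩
      letter i * (2 * 2 ^ r) + (2 * word r (p i) + letter (iter p r (p i)))
        ≡⟨ regroup (letter i) (2 ^ r) (word r (p i)) _ ⟩
      2 * word (suc r) i + letter (iter p r (p i))
        ≡⟨ cong (λ j → 2 * word (suc r) i + letter j) (iter-iter p r 1 i) ⟩
      2 * word (suc r) i + letter (iter p (suc r) i) ∎
      where
      open ≡-Reasoning
      regroup : ∀ b e w c → b * (2 * e) + (2 * w + c) ≡ 2 * (b * e + w) + c
      regroup = solve-∀

    private
      k : ℕ
      k = suc k′
      2^k≡1+M : 2 ^ k ≡ suc M
      2^k≡1+M = sym 2+L≡2^k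

    word-step : ∀ i → word k (p i) + letter i * M ≡ 2 * word k i
    word-step i = +-cancelʳ-≡ (letter i) _ _ (begin
      (word k (p i) + letter i * M) + letter i  ≡⟨ regroup (word k (p i)) (letter i) M ⟩
      letter i * suc M + word k (p i)           ≡⟨ cong (λ e → letter i * e + word k (p i)) (sym 2^k≡1+M) ⟩
      word (suc k) i                            ≡⟨ word-snoc k i ⟩
      2 * word k i + letter (iter p k i)        ≡⟨ cong (λ j → 2 * word k i + letter j) (p^k i) ⟩
      2 * word k i + letter i                   ∎)
      where
      open ≡-Reasoning
      regroup : ∀ w b m → (w + b * m) + b ≡ b * (1 + m) + w
      regroup = solve-∀

    word≤M : ∀ i → word k i ≤ M
    word≤M i = ℕ.s≤s⁻¹ (subst (word k i <_) 2^k≡1+M (word<2^ k i))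

    -- By `word-step` the value 0 is inherited by `p i` and rules out the letter 1, so every further
    -- step would ascend. `word≢M` is the mirror image with descents.
    word≢0 : ∀ i → word k i ≢ 0
    word≢0 = no-ascent p (λ i → word k i ≡ 0) step
      where
      step : ∀ i → word k i ≡ 0 → word k (p i) ≡ 0 × toℕ i < toℕ (p i)
      step i w≡0 with trans (word-step i) (cong (2 *_) w≡0)
      ... | eq with direction i
      ...   | inj₁ lt = m+n≡0⇒m≡0 (word k (p i)) eq , lt
      ...   | inj₂ gt = contradiction (trans (sym (cong (_* M) (letter-down gt))) (m+n≡0⇒n≡0 (word k (p i)) eq)) λ ()

    word≢M : ∀ i → word k i ≢ M
    word≢M = no-descent p (λ i → word k i ≡ M) step
      where
      step : ∀ i → word k i ≡ M → word k (p i) ≡ M × toℕ (p i) < toℕ i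
      step i w≡M with trans (word-step i) (cong (2 *_) w≡M)
      ... | eq with direction i
      ...   | inj₂ gt = +-cancelʳ-≡ (1 * M) _ _ (trans (cong (λ b → word k (p i) + b * M) (sym (letter-down gt))) eq) , gt
      ...   | inj₁ lt = contradiction (word≤M (p i)) (<⇒≱ (begin-strict
                M                             <⟨ m<m+n M {M + 0} (s≤s z≤n) ⟩
                2 * M                         ≡⟨ sym eq ⟩
                word k (p i) + letter i * M   ≡⟨ cong (λ b → word k (p i) + b * M) (letter-up lt) ⟩
                word k (p i) + 0              ≡⟨ +-identityʳ _ ⟩
                word k (p i)                  ∎))
        where open ≤-Reasoning

    private
      toIndex : ∀ w → w ≢ 0 → w < M → Σ[ v ∈ Fin L ] suc (toℕ v) ≡ w
      toIndex zero    w≢0 _ = contradiction refl w≢0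
      toIndex (suc w) _ (s≤s w<L) = fromℕ< w<L , cong suc (Finₚ.toℕ-fromℕ< w<L)

      indexed : ∀ i → Σ[ v ∈ Fin L ] suc (toℕ v) ≡ word k i
      indexed i = toIndex (word k i) (word≢0 i) (≤∧≢⇒< (word≤M i) (word≢M i))

    abstract
      itinerary : Fin n → Fin L
      itinerary i = proj₁ (indexed i)

      suc-itinerary : ∀ i → suc (toℕ (itinerary i)) ≡ word k i
      suc-itinerary i = proj₂ (indexed i)

    itinerary-sorted : Sorted (toℕ ∘ itinerary)
    itinerary-sorted {i} {j} i≤j = ℕ.s≤s⁻¹ (subst₂ _≤_ (sym (suc-itinerary i)) (sym (suc-itinerary j)) (word-sorted k i≤j))

    itinerary-double : ∀ i → double (itinerary i) ≡ itinerary (p i)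
    itinerary-double i = double-unique (itinerary i) (itinerary (p i)) (letter i)
      (trans (cong (_+ letter i * M) (suc-itinerary (p i))) (trans (word-step i) (cong (2 *_) (sym (suc-itinerary i)))))

    -- Sortedness of `x` forces `p` at i and doubling at `x i` to go in the same direction, so the
    -- residue of `x i` obeys the same recursion as the words, with the same letters. Unrolled k
    -- times, it says that 2^k X = word * M + X, and 2^k = M + 1 leaves X = word.
    itinerary-unique : (x : Fin n → Fin L) → Sorted (toℕ ∘ x) → (∀ i → x (p i) ≡ double (x i)) → ∀ i → itinerary i ≡ x i
    itinerary-unique x sorted x-double i = Finₚ.toℕ-injective (suc-injective (trans
      (suc-itinerary i) (*-cancelʳ-≡ _ _ M (sym (+-cancelʳ-≡ X _ _ (begin
      X * M + X                    ≡⟨ regroup X M ⟩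
      suc M * X                    ≡⟨ cong (_* X) (sym 2^k≡1+M) ⟩
      2 ^ k * X                    ≡⟨ expand k i ⟩
      word k i * M + val (iter p k i) ≡⟨ cong (λ j → word k i * M + val j) (p^k i) ⟩
      word k i * M + X             ∎))))))
      where
      open ≡-Reasoning
      val : Fin n → ℕ
      val i = suc (toℕ (x i))
      X : ℕ
      X = val i
      regroup : ∀ x m → x * m + x ≡ (1 + m) * x
      regroup = solve-∀
      step : ∀ i → 2 * val i ≡ letter i * M + val (p i)
      step i with double-direction (x i) | direction i
      ... | inj₁ (_ , eq) | inj₁ lt = trans (sym eq) (trans (cong (suc ∘ toℕ) (sym (x-double i)))
              (cong (λ b → b * M + val (p i)) (sym (letter-up lt))))
      ... | inj₂ (_ , eq) | inj₂ gt = trans (sym eq) (trans (+-comm _ M) (trans (cong (λ u → M + suc (toℕ u)) (sym (x-double i)))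
              (cong (_+ val (p i)) (trans (sym (*-identityˡ M)) (cong (_* M) (sym (letter-down gt)))))))
      ... | inj₁ (lt , _) | inj₂ gt = contradiction (sorted (<⇒≤ gt)) (<⇒≱ (subst (λ u → toℕ (x i) < toℕ u) (sym (x-double i)) lt))
      ... | inj₂ (gt , _) | inj₁ lt = contradiction (sorted (<⇒≤ lt)) (<⇒≱ (subst (λ u → toℕ u < toℕ (x i)) (sym (x-double i)) gt))
      expand : ∀ r i → 2 ^ r * val i ≡ word r i * M + val (iter p r i)
      expand zero    i = *-identityˡ (val i)
      expand (suc r) i = begin
        2 ^ suc r * val i
          ≡⟨ assoc (2 ^ r) (val i) ⟩
        2 ^ r * (2 * val i)
          ≡⟨ cong (2 ^ r *_) (step i) ⟩
        2 ^ r * (letter i * M + val (p i))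
          ≡⟨ *-distribˡ-+ (2 ^ r) (letter i * M) (val (p i)) ⟩
        2 ^ r * (letter i * M) + 2 ^ r * val (p i)
          ≡⟨ cong (2 ^ r * (letter i * M) +_) (expand r (p i)) ⟩
        2 ^ r * (letter i * M) + (word r (p i) * M + val (iter p r (p i)))
          ≡⟨ collect (2 ^ r) (letter i) M (word r (p i)) _ ⟩
        word (suc r) i * M + val (iter p r (p i))
          ≡⟨ cong (λ j → word (suc r) i * M + val j) (iter-iter p r 1 i) ⟩
        word (suc r) i * M + val (iter p (suc r) i) ∎
        where
        assoc : ∀ e v → (2 * e) * v ≡ e * (2 * v)
        assoc = solve-∀
        collect : ∀ e b m w c → e * (b * m) + (w * m + c) ≡ (b * e + w) * m + c
        collect = solve-∀

  module FromSequence {n} (x : Fin n → Fin L) (sorted : Sorted (toℕ ∘ x)) (p : Fin n → Fin n)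
                      (p-double : ∀ i → x (p i) ≡ double (x i))
                      (p-mono : ∀ {i j} → Before (toℕ ∘ double ∘ x) i j → toℕ (p i) < toℕ (p j)) where

    private
      p-up : ∀ {i} → toℕ (x i) < toℕ (double (x i)) → toℕ i < toℕ (p i)
      p-up {i} lt = ≰⇒> λ le → <⇒≱ lt (subst (λ u → toℕ u ≤ toℕ (x i)) (p-double i) (sorted le))

      p-down : ∀ {i} → toℕ (double (x i)) < toℕ (x i) → toℕ (p i) < toℕ i
      p-down {i} gt = ≰⇒> λ le → <⇒≱ gt (subst (λ u → toℕ (x i) ≤ toℕ u) (p-double i) (sorted le))

      p-tie : ∀ {i j} → x i ≡ x j → toℕ i < toℕ j → toℕ (p i) < toℕ (p j)
      p-tie eq i<j = p-mono (inj₂ (cong (toℕ ∘ double) eq , i<j))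

    -- At positions with different values the inequalities come from the two runs of `double`; at
    -- positions with equal values they come from the breaking of ties by position.
    p-twoRuns : TwoRuns p
    p-twoRuns = record { no-fix = λ i eq → double-≢ (x i) (trans (sym (p-double i)) (cong x eq)) ; up = up ; down = down }
      where
      up : ∀ {i j} → toℕ j < toℕ (p j) → toℕ i < toℕ j → toℕ i < toℕ (p i) × toℕ (p i) < toℕ (p j)
      up {i} {j} upj i<j with TwoRuns.direction double-twoRuns (x j)
      ... | inj₂ gt = contradiction upj (<-asym (p-down gt))
      ... | inj₁ lt with m≤n⇒m<n∨m≡n (sorted (<⇒≤ i<j))
      ...   | inj₁ xi<xj = let (lti , mono) = double-up lt xi<xj in p-up lti , p-mono (inj₁ mono)
      ...   | inj₂ xi≡xj with eq ← Finₚ.toℕ-injective xi≡xj =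
                p-up (subst (λ u → toℕ u < toℕ (double u)) (sym eq) lt) , p-tie eq i<j
      down : ∀ {i j} → toℕ (p i) < toℕ i → toℕ i < toℕ j → toℕ (p j) < toℕ j × toℕ (p i) < toℕ (p j)
      down {i} {j} dni i<j with TwoRuns.direction double-twoRuns (x i)
      ... | inj₁ lt = contradiction dni (<-asym (p-up lt))
      ... | inj₂ gt with m≤n⇒m<n∨m≡n (sorted (<⇒≤ i<j))
      ...   | inj₁ xi<xj = let (gtj , mono) = double-down gt xi<xj in p-down gtj , p-mono (inj₁ mono)
      ...   | inj₂ xi≡xj with eq ← Finₚ.toℕ-injective xi≡xj =
                p-down (subst (λ u → toℕ (double u) < toℕ u) eq gt) , p-tie eq i<j

    private
      iter-p : ∀ r i → x (iter p r i) ≡ iter double r (x i)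
      iter-p zero    i = refl
      iter-p (suc r) i = trans (p-double (iter p r i)) (cong double (iter-p r i))

      iter-tie : ∀ r {i j} → x i ≡ x j → toℕ i < toℕ j → toℕ (iter p r i) < toℕ (iter p r j)
      iter-tie zero    eq i<j = i<j
      iter-tie (suc r) {i} {j} eq i<j =
        p-tie (trans (iter-p r i) (trans (cong (iter double r) eq) (sym (iter-p r j)))) (iter-tie r eq i<j)

    -- The k-th power preserves the level sets of x and is increasing on them, so a point it moved would
    -- start an endless monotone chain.
    p^k : ∀ i → iter p (suc k′) i ≡ i
    p^k i with <-cmp (toℕ i) (toℕ (iter p (suc k′) i))
    ... | tri≈ _ eq _ = sym (Finₚ.toℕ-injective eq)
    ... | tri< lt _ _ = contradiction lt (no-ascent g (λ i → toℕ i < toℕ (g i)) (λ i lt → iter-tie (suc k′) (level i) lt , lt) i)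
      where
      g : Fin n → Fin n
      g = iter p (suc k′)
      level : ∀ i → x i ≡ x (g i)
      level i = sym (trans (iter-p (suc k′) i) (double^k (x i)))
    ... | tri> _ _ gt = contradiction gt (no-descent g (λ i → toℕ (g i) < toℕ i) (λ i gt → iter-tie (suc k′) (level i) gt , gt) i)
      where
      g : Fin n → Fin n
      g = iter p (suc k′)
      level : ∀ i → x (g i) ≡ x i
      level i = trans (iter-p (suc k′) i) (double^k (x i))

-- Grassmannian permutations

-- The two blocks are the positions before `c` and those from `c` on. The inequalities are weak so
-- that they can be read off `desL` alone; strictness is added once injectivity is known.
Runs : ∀ {l} → Vec (Fin n) l → ℕ → Set
Runs v c = ∀ {i j} → toℕ i ≤ toℕ j → toℕ j < c ⊎ c ≤ toℕ i → toℕ (lookup v i) ≤ toℕ (lookup v j)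

descent≡0 : ∀ {a b : Fin n} → ⟦ toℕ b <? toℕ a ⟧ ≡ 0 → toℕ a ≤ toℕ b
descent≡0 {a = a} {b} eq = ≮⇒≥ λ b<a → contradiction (trans (sym eq) (⟦⟧-yes (toℕ b <? toℕ a) b<a)) λ ()

desL≡0⇒runs : ∀ {l} (v : Vec (Fin n) l) → desL (toList v) ≡ 0 → Runs v 0
desL≡0⇒runs (a ∷ [])    _  {zero}  {zero}  _         _ = ≤-refl
desL≡0⇒runs (a ∷ b ∷ v) eq {zero}  {zero}  _         _ = ≤-refl
desL≡0⇒runs (a ∷ b ∷ v) eq {zero}  {suc j} _         _ =
  ≤-trans (descent≡0 {a = a} {b} (m+n≡0⇒m≡0 _ eq)) (desL≡0⇒runs (b ∷ v) (m+n≡0⇒n≡0 ⟦ toℕ b <? toℕ a ⟧ eq) {zero} {j} z≤n (inj₂ z≤n))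
desL≡0⇒runs (a ∷ b ∷ v) eq {suc i} {suc j} (s≤s i≤j) _ =
  desL≡0⇒runs (b ∷ v) (m+n≡0⇒n≡0 ⟦ toℕ b <? toℕ a ⟧ eq) i≤j (inj₂ z≤n)

runs-cons : ∀ {l} (a : Fin n) (v : Vec (Fin n) l) c → (∀ j → toℕ j < c → toℕ a ≤ toℕ (lookup v j)) → Runs v c → Runs (a ∷ v) (suc c)
runs-cons a v c a≤ runs {zero}  {zero}  _         _                  = ≤-refl
runs-cons a v c a≤ runs {zero}  {suc j} _         (inj₁ (s≤s j<c))   = a≤ j j<c
runs-cons a v c a≤ runs {suc i} {suc j} (s≤s i≤j) (inj₁ (s≤s j<c))   = runs i≤j (inj₁ j<c)
runs-cons a v c a≤ runs {suc i} {suc j} (s≤s i≤j) (inj₂ (s≤s c≤i))   = runs i≤j (inj₂ c≤i)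

desL≤1⇒runs : ∀ {l} (v : Vec (Fin n) l) → desL (toList v) ≤ 1 → ∃ λ c → Runs v c
desL≤1⇒runs []          _  = 0 , λ { {()} }
desL≤1⇒runs (a ∷ [])    _  = 0 , desL≡0⇒runs (a ∷ []) refl
desL≤1⇒runs (a ∷ b ∷ v) le = split (toℕ b <? toℕ a) refl (desL≤1⇒runs (b ∷ v) (m+n≤o⇒n≤o ⟦ toℕ b <? toℕ a ⟧ le))
  where
  split : (d : Dec (toℕ b < toℕ a)) → ⟦ d ⟧ ≡ ⟦ toℕ b <? toℕ a ⟧ → (∃ λ c → Runs (b ∷ v) c) → ∃ λ c → Runs (a ∷ b ∷ v) c
  -- This descent uses up the only one allowed, so the cut is here and the tail is a single run.
  split (yes b<a) eq _ = 1 , runs-cons a (b ∷ v) 0 (λ _ ()) (desL≡0⇒runs (b ∷ v)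
    (n≤0⇒n≡0 (ℕ.s≤s⁻¹ (subst (λ x → x + desL (toList (b ∷ v)) ≤ 1) (sym eq) le))))
  split (no b≮a) _ (c , runs) =
    suc c , runs-cons a (b ∷ v) c (λ j j<c → ≤-trans (≮⇒≥ b≮a) (runs {zero} {j} z≤n (inj₁ j<c))) runs

runs-tail : ∀ {l} {a : Fin n} {v : Vec (Fin n) l} {c} → Runs (a ∷ v) c → Runs v (c ∸ 1)
runs-tail {c = zero}  runs i≤j _                = runs (s≤s i≤j) (inj₂ z≤n)
runs-tail {c = suc c} runs i≤j (inj₁ j<c)       = runs (s≤s i≤j) (inj₁ (s≤s j<c))
runs-tail {c = suc c} runs i≤j (inj₂ c≤i)       = runs (s≤s i≤j) (inj₂ (s≤s c≤i))

runs⇒desL≡0 : ∀ {l} (v : Vec (Fin n) l) → Runs v 0 → desL (toList v) ≡ 0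
runs⇒desL≡0 []          runs = refl
runs⇒desL≡0 (a ∷ [])    runs = refl
runs⇒desL≡0 (a ∷ b ∷ v) runs = cong₂ _+_
  (⟦⟧-no (toℕ b <? toℕ a) (≤⇒≯ (runs {zero} {suc zero} z≤n (inj₂ z≤n)))) (runs⇒desL≡0 (b ∷ v) (λ {i} {j} → runs-tail {c = 0} runs {i} {j}))

runs⇒desL≤1 : ∀ {l} (v : Vec (Fin n) l) c → Runs v c → desL (toList v) ≤ 1
runs⇒desL≤1 v           zero          runs = ≤-trans (≤-reflexive (runs⇒desL≡0 v runs)) z≤n
runs⇒desL≤1 []          (suc c)       runs = z≤n
runs⇒desL≤1 (a ∷ [])    (suc c)       runs = z≤n
runs⇒desL≤1 (a ∷ b ∷ v) (suc zero)    runs = +-mono-≤ {y = 1} (⟦⟧≤1 (toℕ b <? toℕ a))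
  (≤-reflexive (runs⇒desL≡0 (b ∷ v) (λ {i} {j} → runs-tail {c = 1} runs {i} {j})))
runs⇒desL≤1 (a ∷ b ∷ v) (suc (suc c)) runs = +-mono-≤
  (≤-reflexive (⟦⟧-no (toℕ b <? toℕ a) (≤⇒≯ (runs {zero} {suc zero} z≤n (inj₁ (s≤s (s≤s z≤n)))))))
  (runs⇒desL≤1 (b ∷ v) (suc c) (λ {i} {j} → runs-tail {c = 2 + c} runs {i} {j}))

pow≡iter : (π : Vec (Fin n) n) → ∀ k i → pow π k i ≡ iter (lookup π) k i
pow≡iter π zero    i = refl
pow≡iter π (suc k) i = cong (lookup π) (pow≡iter π k i)

module _ k {m} (π : Vec (Fin (suc m)) (suc m)) (good : Good (suc k) m π) where

  private
    p : Fin (suc m) → Fin (suc m)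
    p = lookup π

  good⇒periodic : ∀ i → iter p (suc k) i ≡ i
  good⇒periodic i = trans (sym (pow≡iter π (suc k) i)) (proj₂ (proj₂ (proj₂ (proj₂ good))) i)

  -- On the first block `p` starts above the diagonal, as π(1) ≠ 1, and stays there because each
  -- step raises the value by at least one. On the second block the same argument runs downwards
  -- from π(n) ≠ n. The cut thus separates the points moved up from those moved down.
  good⇒twoRuns : TwoRuns p
  good⇒twoRuns with desL≤1⇒runs π (proj₁ (proj₂ good))
  ... | c , runs = record { no-fix = no-fix ; up = up ; down = down }
    where
    strict : ∀ {i j} → toℕ i < toℕ j → toℕ j < c ⊎ c ≤ toℕ i → toℕ (p i) < toℕ (p j)
    strict i<j side = ≤∧≢⇒< (runs (<⇒≤ i<j) side) λ eq →
      <⇒≢ i<j (cong toℕ (periodic-injective p k good⇒periodic (Finₚ.toℕ-injective eq)))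
    first : ∀ i → toℕ i < c → toℕ i < toℕ (p i)
    first = FinInd.<-weakInduction (λ i → toℕ i < c → toℕ i < toℕ (p i))
      (λ _ → ≤∧≢⇒< z≤n λ eq → proj₁ (proj₂ (proj₂ good)) (sym (Finₚ.toℕ-injective eq)))
      λ i ih i<c → let pred<i = ≤-reflexive (cong suc (Finₚ.toℕ-inject₁ i)) in
        ≤-<-trans (≤-trans (≤-reflexive (cong suc (sym (Finₚ.toℕ-inject₁ i)))) (ih (<-trans pred<i i<c))) (strict pred<i (inj₁ i<c))
    second : ∀ i → c ≤ toℕ i → toℕ (p i) < toℕ i
    second = FinInd.>-weakInduction (λ i → c ≤ toℕ i → toℕ (p i) < toℕ i)
      (λ _ → ≤∧≢⇒< (Finₚ.≤fromℕ (p (Fin.fromℕ m))) λ eq → proj₁ (proj₂ (proj₂ (proj₂ good))) (Finₚ.toℕ-injective eq))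
      λ i ih c≤i → let i<suc = ≤-reflexive (cong suc (Finₚ.toℕ-inject₁ i)) in
        <-≤-trans (strict i<suc (inj₂ c≤i)) (≤-trans (ℕ.s≤s⁻¹ (ih (≤-trans c≤i (<⇒≤ i<suc)))) (≤-reflexive (sym (Finₚ.toℕ-inject₁ i))))
    no-fix : ∀ i → p i ≢ i
    no-fix i eq with toℕ i <? c
    ... | yes i<c = <-irrefl (sym (cong toℕ eq)) (first i i<c)
    ... | no  i≮c = <-irrefl (cong toℕ eq) (second i (≮⇒≥ i≮c))
    up : ∀ {i j} → toℕ j < toℕ (p j) → toℕ i < toℕ j → toℕ i < toℕ (p i) × toℕ (p i) < toℕ (p j)
    up {i} {j} upj i<j with toℕ j <? c
    ... | yes j<c = first i (<-trans i<j j<c) , strict i<j (inj₁ j<c)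
    ... | no  j≮c = contradiction upj (<-asym (second j (≮⇒≥ j≮c)))
    down : ∀ {i j} → toℕ (p i) < toℕ i → toℕ i < toℕ j → toℕ (p j) < toℕ j × toℕ (p i) < toℕ (p j)
    down {i} {j} dni i<j with toℕ i <? c
    ... | yes i<c = contradiction dni (<-asym (first i i<c))
    ... | no  i≮c = second j (≤-trans (≮⇒≥ i≮c) (<⇒≤ i<j)) , strict i<j (inj₂ (≮⇒≥ i≮c))

module _ {m} (p : Fin (suc m) → Fin (suc m)) (twoRuns : TwoRuns p) where

  private
    open TwoRuns twoRuns
    π : Vec (Fin (suc m)) (suc m)
    π = Vec.tabulate p
    lookup-π : ∀ i → lookup π i ≡ p i
    lookup-π = Vecₚ.lookup∘tabulate p

    isDown : Fin (suc m) → ℕ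
    isDown i = ⟦ toℕ (p i) <? toℕ i ⟧

    isDown-sorted : Sorted isDown
    isDown-sorted {i} {j} i≤j = ⟦⟧-mono (toℕ (p i) <? toℕ i) (toℕ (p j) <? toℕ j) λ dni →
      [ (λ i<j → proj₁ (down dni i<j)) , (λ i≡j → subst (λ i → toℕ (p i) < toℕ i) (Finₚ.toℕ-injective i≡j) dni) ]′ (m≤n⇒m<n∨m≡n i≤j)

    -- `isDown` is a sorted sequence of zeros and ones; the number of its zeros is the position of
    -- the jump.
    cut : ℕ
    cut = # (λ i → isDown i <? 1)

    <cut⇒up : ∀ j → toℕ j < cut → toℕ j < toℕ (p j)
    <cut⇒up j j<c with direction j
    ... | inj₁ lt = lt
    ... | inj₂ gt = contradiction (sorted-below⁻ isDown-sorted j 1 j<c) (≤⇒≯ (≤-reflexive (sym (⟦⟧-yes (toℕ (p j) <? toℕ j) gt))))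

    ≥cut⇒down : ∀ i → cut ≤ toℕ i → toℕ (p i) < toℕ i
    ≥cut⇒down i c≤i with direction i
    ... | inj₂ gt = gt
    ... | inj₁ lt = contradiction (sorted-below⁺ isDown-sorted i 1 (s≤s (≤-reflexive (⟦⟧-no (toℕ (p i) <? toℕ i) (<-asym lt))))) (≤⇒≯ c≤i)

    mono : ∀ {i j} → toℕ i ≤ toℕ j → toℕ j < cut ⊎ cut ≤ toℕ i → toℕ (p i) ≤ toℕ (p j)
    mono {i} {j} i≤j side with m≤n⇒m<n∨m≡n i≤j | side
    ... | inj₂ i≡j | _        = ≤-reflexive (cong (toℕ ∘ p) (Finₚ.toℕ-injective i≡j))
    ... | inj₁ i<j | inj₁ j<c = <⇒≤ (proj₂ (up (<cut⇒up j j<c) i<j))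
    ... | inj₁ i<j | inj₂ c≤i = <⇒≤ (proj₂ (down (≥cut⇒down i c≤i) i<j))

  twoRuns⇒good : ∀ k → (∀ i → iter p (suc k) i ≡ i) → Good (suc k) m (Vec.tabulate p)
  twoRuns⇒good k p^k =
      subst Unique (toList-tabulate p) (Uniqueₚ.tabulate⁺ (periodic-injective p k p^k))
    , runs⇒desL≤1 π cut (λ {i} {j} i≤j side → subst₂ _≤_ (cong toℕ (sym (lookup-π i))) (cong toℕ (sym (lookup-π j))) (mono i≤j side))
    , (λ eq → no-fix zero (trans (sym (lookup-π zero)) eq))
    , (λ eq → no-fix (Fin.fromℕ m) (trans (sym (lookup-π (Fin.fromℕ m))) eq))
    , λ i → trans (pow-π (suc k) i) (p^k i)
    where
    toList-tabulate : ∀ {l} {A : Set} (f : Fin l → A) → List.tabulate f ≡ toList (Vec.tabulate f)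
    toList-tabulate {zero}  f = refl
    toList-tabulate {suc l} f = cong (f zero ∷_) (toList-tabulate (f ∘ suc))
    pow-π : ∀ k i → pow π k i ≡ iter p k i
    pow-π zero    i = refl
    pow-π (suc k) i = trans (lookup-π (pow π k i)) (cong p (pow-π k i))

-- The correspondence

module _ {A B : Set} {P : A → Set} (P? : ∀ a → Dec (P a)) {xs : List A} (unique : Unique xs) (complete : ∀ a → a ∈ xs)
         (to : ∀ a → P a → B) (from : B → A) (from-P : ∀ b → P (from b))
         (from-to : ∀ a Pa → from (to a Pa) ≡ a) (to-from : ∀ b a Pa → a ≡ from b → to a Pa ≡ b) where

  -- The proof of `P` stored for a list element need not be the one supplied by `from-P`; this is
  -- why `from-to` and `to-from` are required for an arbitrary proof, and the latter for any `a`
  -- equal to `from b`.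
  filter-↔ : Fin (length (filter P? xs)) ↔ B
  filter-↔ = mk↔ₛ′ f g (λ b → to-from b _ _ (sym (Anyₚ.lookup-index (member b))))
    λ i → unique⇒lookup-injective (Uniqueₚ.filter⁺ P? unique) _ _
      (trans (sym (Anyₚ.lookup-index (member (f i)))) (from-to _ _))
    where
    member : ∀ b → from b ∈ filter P? xs
    member b = ∈ₚ.∈-filter⁺ P? (complete (from b)) (from-P b)
    f : Fin (length (filter P? xs)) → B
    f i = to (List.lookup (filter P? xs) i) (All.lookup (Allₚ.all-filter P? xs) (∈ₚ.∈-lookup i))
    g : B → Fin (length (filter P? xs))
    g b = Any.index (member b)

words-complete : ∀ n m (v : Vec (Fin n) m) → v ∈ words n m
words-complete n zero    []      = here refl
words-complete n (suc m) (a ∷ v) = ∈ₚ.∈-concatMap⁺ (λ a → map (a ∷_) (words n m))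
  (Any.map (λ { refl → ∈ₚ.∈-map⁺ (a ∷_) (words-complete n m v) }) (∈ₚ.∈-allFin a))

words-unique : ∀ n m → Unique (words n m)
words-unique n zero    = [] ∷ []
words-unique n (suc m) = subst Unique (product≡concatMap (allFin n))
  (Uniqueₚ.cartesianProductWith⁺ _∷_ Vecₚ.∷-injective (Uniqueₚ.allFin⁺ n) (words-unique n m))
  where
  product≡concatMap : ∀ as → List.cartesianProductWith _∷_ as (words n m) ≡ concatMap (λ a → map (a ∷_) (words n m)) as
  product≡concatMap []       = refl
  product≡concatMap (a ∷ as) = cong (map (a ∷_) (words n m) ++_) (product≡concatMap as)

-- The weight list is made a parameter so that it can be replaced by an equal list such as
-- `replicate (N k) k`.
SolutionsOf : List ℕ → ℕ → Set
SolutionsOf ws n = Σ[ x ∈ Vec ℕ (length ws) ] weightedSum ws (toList x) ≡ n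

solution-≡ : ∀ {ws n} {s t : SolutionsOf ws n} → proj₁ s ≡ proj₁ t → s ≡ t
solution-≡ {s = x , eq} {t = .x , eq′} refl = cong (x ,_) (≡-irrelevant eq eq′)

weightedSum-sum : ∀ ws (x : Vec ℕ (length ws)) → weightedSum ws (toList x) ≡ sum (λ i → List.lookup ws i * lookup x i)
weightedSum-sum []       []      = refl
weightedSum-sum (w ∷ ws) (a ∷ x) = cong (w * a +_) (weightedSum-sum ws x)

module Bijection (k′ L : ℕ) (2+L≡2^k : 2 + L ≡ 2 ^ suc k′) where

  open Doubling k′ L 2+L≡2^k
  open Itineraries k′ L 2+L≡2^k
  open Orbits double k′ double^k

  module _ {ws} (indexing : OrbitIndexing ws) (m : ℕ) where

    open OrbitIndexing indexing

    private
      n′ : ℕ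
      n′ = suc m

      occurrences : (Fin n′ → Fin L) → Fin L → ℕ
      occurrences x v = # (λ l → x l Finₚ.≟ v)

      Invariant : (Fin L → ℕ) → Set
      Invariant f = ∀ v → f (double v) ≡ f v

      invariant-iter : ∀ {f} → Invariant f → ∀ i v → f (iter double i v) ≡ f v
      invariant-iter inv zero    v = refl
      invariant-iter inv (suc i) v = trans (inv (iter double i v)) (invariant-iter inv i v)

      invariant-element : ∀ {f} → Invariant f → ∀ v → f (elementOf (orbitOf v)) ≡ f v
      invariant-element {f} inv v = let (i , eq) = elementOf-orbitOf v in
        trans (cong f (sym eq)) (invariant-iter inv i v)

      sum-orbits : (x : Vec ℕ (length ws)) → sum (λ v → lookup x (orbitOf v)) ≡ weightedSum ws (toList x)
      sum-orbits x = begin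
        sum (λ v → lookup x (orbitOf v))
          ≡⟨ sum-fibres orbitOf (lookup x) ⟩
        sum (λ i → # (λ v → orbitOf v Finₚ.≟ i) * lookup x i)
          ≡⟨ sum-cong-≗ (λ i → cong (_* lookup x i) (orbit-weight i)) ⟩
        sum (λ i → List.lookup ws i * lookup x i)
          ≡⟨ sym (weightedSum-sum ws x) ⟩
        weightedSum ws (toList x) ∎
        where open ≡-Reasoning

      onOrbits : (Fin L → ℕ) → Vec ℕ (length ws)
      onOrbits f = Vec.tabulate (f ∘ elementOf)

      lookup-onOrbits : ∀ {f} → Invariant f → ∀ v → lookup (onOrbits f) (orbitOf v) ≡ f v
      lookup-onOrbits {f} inv v = trans (Vecₚ.lookup∘tabulate (f ∘ elementOf) (orbitOf v)) (invariant-element inv v)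

      sum-occurrences : ∀ x → sum (occurrences x) ≡ n′
      sum-occurrences x = begin
        sum (occurrences x)                ≡⟨ sum-cong-≗ (λ v → sym (*-identityʳ (occurrences x v))) ⟩
        sum (λ v → occurrences x v * 1)    ≡⟨ sym (sum-fibres x (λ _ → 1)) ⟩
        sum {n′} (λ _ → 1)                 ≡⟨ sum-const n′ 1 ⟩
        n′ * 1                             ≡⟨ *-identityʳ n′ ⟩
        n′                                 ∎
        where open ≡-Reasoning

    module FromPermutation (p : Fin n′ → Fin n′) (runs : TwoRuns p) (p^k : ∀ i → iter p (suc k′) i ≡ i) where

      open Itinerary p runs p^k

      -- Substituting `p l` for `l` turns the value `double v` into `v`, since doubling is
      -- injective.
      occurrences-invariant : Invariant (occurrences itinerary)
      occurrences-invariant v = begin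
        # (λ l → itinerary l Finₚ.≟ double v)
          ≡⟨ sym (sum-image p (periodic-injective p k′ p^k) (λ l → ⟦ itinerary l Finₚ.≟ double v ⟧)
               (λ l miss → contradiction (p^k l) (miss (iter p k′ l)))) ⟩
        # (λ l → itinerary (p l) Finₚ.≟ double v)
          ≡⟨ #-cong (λ l → itinerary (p l) Finₚ.≟ double v) (λ l → itinerary l Finₚ.≟ v)
               (λ l eq → periodic-injective double k′ double^k (trans (itinerary-double l) eq))
               (λ l eq → trans (sym (itinerary-double l)) (cong double eq)) ⟩
        # (λ l → itinerary l Finₚ.≟ v) ∎
        where open ≡-Reasoning

      solution : SolutionsOf ws n′
      solution = onOrbits (occurrences itinerary) , (begin
        weightedSum ws (toList (onOrbits (occurrences itinerary)))
          ≡⟨ sym (sum-orbits (onOrbits (occurrences itinerary))) ⟩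
        sum (λ v → lookup (onOrbits (occurrences itinerary)) (orbitOf v))
          ≡⟨ sum-cong-≗ (lookup-onOrbits occurrences-invariant) ⟩
        sum (occurrences itinerary)
          ≡⟨ sum-occurrences itinerary ⟩
        n′ ∎)
        where open ≡-Reasoning

    module FromSolution (s : SolutionsOf ws n′) where

      multiplicity : Fin L → ℕ
      multiplicity v = lookup (proj₁ s) (orbitOf v)

      open Arrange multiplicity (trans (sum-orbits (proj₁ s)) (proj₂ s)) renaming (arrange to x) public
      open Standardization (toℕ ∘ double ∘ x) public using (std; std-mono; std-unique)

      -- The value v occurs in `double ∘ x` as often as its half occurs in `x`. The half is
      -- `iter double k′ v`, a point of the same orbit and so of the same multiplicity. Hence
      -- `double ∘ x` rearranges `x`, and `sort-std` applies.
      x-double : ∀ i → x (std i) ≡ double (x i)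
      x-double i = Finₚ.toℕ-injective (sort-std (toℕ ∘ x) (toℕ ∘ double ∘ x) arrange-sorted
        (toℕ-sameCounts x (double ∘ x) balanced) i)
        where
        open ≡-Reasoning
        multiplicity-invariant : Invariant multiplicity
        multiplicity-invariant v = cong (lookup (proj₁ s)) (orbitOf-T v)
        balanced : ∀ v → occurrences x v ≡ occurrences (double ∘ x) v
        balanced v = begin
          occurrences x v                        ≡⟨ arrange-count v ⟩
          multiplicity v                         ≡⟨ sym (invariant-iter multiplicity-invariant k′ v) ⟩
          multiplicity (iter double k′ v)        ≡⟨ sym (arrange-count (iter double k′ v)) ⟩
          occurrences x (iter double k′ v)
            ≡⟨ #-cong (λ l → x l Finₚ.≟ iter double k′ v) (λ l → double (x l) Finₚ.≟ v)
                 (λ l eq → trans (cong double eq) (double^k v))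
                 (λ l eq → periodic-injective double k′ double^k (trans eq (sym (double^k v)))) ⟩
          occurrences (double ∘ x) v             ∎

      open FromSequence x arrange-sorted std x-double std-mono public using () renaming (p-twoRuns to std-twoRuns; p^k to std^k)

      permutation : Vec (Fin n′) n′
      permutation = Vec.tabulate std

      permutation-good : Good (suc k′) m permutation
      permutation-good = twoRuns⇒good std std-twoRuns k′ std^k

      -- The multiplicities identify `x` with the itinerary of `p`. It then remains to see that `p`
      -- respects the order being standardized, after which `std-unique` applies; the only delicate
      -- case is a tie.
      permutation-unique : (p : Fin n′ → Fin n′) (runs : TwoRuns p) (p^k : ∀ i → iter p (suc k′) i ≡ i) →
                           (∀ v → multiplicity v ≡ occurrences (Itinerary.itinerary p runs p^k) v) →
                           permutation ≡ Vec.tabulate p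
      permutation-unique p runs p^k same = Vecₚ.tabulate-cong std≡p
        where
        open Itinerary p runs p^k
        x≡itinerary : ∀ i → x i ≡ itinerary i
        x≡itinerary i = Finₚ.toℕ-injective (sorted-unique (toℕ ∘ x) (toℕ ∘ itinerary) arrange-sorted itinerary-sorted
          (toℕ-sameCounts x itinerary λ v → trans (arrange-count v) (same v)) i)
        double-x : ∀ i → double (x i) ≡ itinerary (p i)
        double-x i = trans (cong double (x≡itinerary i)) (itinerary-double i)
        p-mono : ∀ {i j} → Before (toℕ ∘ double ∘ x) i j → toℕ (p i) < toℕ (p j)
        p-mono {i} {j} (inj₁ lt) = ≰⇒> λ le → <⇒≱ (subst₂ (λ u v → toℕ u < toℕ v) (double-x i) (double-x j) lt) (itinerary-sorted le)
        p-mono {i} {j} (inj₂ (eq , i<j)) with TwoRuns.direction runs i | TwoRuns.direction runs j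
        ... | inj₂ dni | _        = proj₂ (TwoRuns.down runs dni i<j)
        ... | inj₁ _   | inj₁ upj = proj₂ (TwoRuns.up runs upj i<j)
        -- A tie between an ascending i and a descending j: with x the itinerary, 2 x(i) = x(p j) ≤
        -- x(j) = x(i) ≤ x(p i) = 2 x(i), so doubling would fix x(i).
        ... | inj₁ upi | inj₂ dnj = contradiction (Finₚ.toℕ-injective (≤-antisym
                (subst (λ u → toℕ u ≤ toℕ (itinerary i)) (sym (trans (itinerary-double i) same-image))
                  (≤-trans (itinerary-sorted (<⇒≤ dnj)) (≤-reflexive (cong toℕ (sym same-point)))))
                (subst (λ u → toℕ (itinerary i) ≤ toℕ u) (sym (itinerary-double i)) (itinerary-sorted (<⇒≤ upi)))))
              (double-≢ (itinerary i))
          where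
          same-image : itinerary (p i) ≡ itinerary (p j)
          same-image = trans (sym (double-x i)) (trans (Finₚ.toℕ-injective eq) (double-x j))
          same-point : itinerary i ≡ itinerary j
          same-point = periodic-injective double k′ double^k (trans (itinerary-double i) (trans same-image (sym (itinerary-double j))))
        std≡p : ∀ i → std i ≡ p i
        std≡p = std-unique p (periodic-injective p k′ p^k) (λ v → iter p k′ v , p^k v) p-mono

    to : ∀ π → Good (suc k′) m π → SolutionsOf ws n′
    to π good = FromPermutation.solution (lookup π) (good⇒twoRuns k′ π good) (good⇒periodic k′ π good)

    from : SolutionsOf ws n′ → Vec (Fin n′) n′
    from = FromSolution.permutation

    from-to : ∀ π good → from (to π good) ≡ π
    from-to π good = trans
      (FromSolution.permutation-unique (to π good) (lookup π) runs p^k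
        (lookup-onOrbits (FromPermutation.occurrences-invariant (lookup π) runs p^k)))
      (Vecₚ.tabulate∘lookup π)
      where
      runs : TwoRuns (lookup π)
      runs = good⇒twoRuns k′ π good
      p^k : ∀ i → iter (lookup π) (suc k′) i ≡ i
      p^k = good⇒periodic k′ π good

    to-from : ∀ s π good → π ≡ from s → to π good ≡ s
    to-from s π good refl = solution-≡ {ws = ws} (trans (Vecₚ.tabulate-cong same) (Vecₚ.tabulate∘lookup (proj₁ s)))
      where
      p : Fin n′ → Fin n′
      p = lookup π
      open FromSolution s
      p≡std : ∀ i → p i ≡ std i
      p≡std = Vecₚ.lookup∘tabulate std
      open Itinerary p (good⇒twoRuns k′ π good) (good⇒periodic k′ π good)
      same : ∀ i → occurrences itinerary (elementOf i) ≡ lookup (proj₁ s) i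
      same i = begin
        occurrences itinerary (elementOf i)
          ≡⟨ #-cong (λ l → itinerary l Finₚ.≟ elementOf i) (λ l → x l Finₚ.≟ elementOf i)
               (λ l → trans (sym (itinerary≡x l))) (λ l → trans (itinerary≡x l)) ⟩
        occurrences x (elementOf i)
          ≡⟨ arrange-count (elementOf i) ⟩
        lookup (proj₁ s) (orbitOf (elementOf i))
          ≡⟨ cong (lookup (proj₁ s)) (orbitOf-elementOf i) ⟩
        lookup (proj₁ s) i ∎
        where
        open ≡-Reasoning
        itinerary≡x : ∀ l → itinerary l ≡ x l
        -- The itinerary is built from whatever proof `good` is given; uniqueness identifies it with
        -- `x` all the same.
        itinerary≡x = itinerary-unique x arrange-sorted (λ i → trans (cong x (p≡std i)) (x-double i))

    countGood-↔ : Fin (countGood (suc k′) m) ↔ SolutionsOf ws n′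
    countGood-↔ = filter-↔ {P = Good (suc k′) m} (good? (suc k′) m) {xs = words n′ n′} (words-unique n′ n′) (words-complete n′ n′)
      to from FromSolution.permutation-good from-to to-from

-- Prime exponents

-- The number of vectors of `c` naturals with sum `q`: the first entry is zero or can be lowered by
-- one. The recursion matches `split-first` on solutions and Pascal's rule on binomial coefficients.
starsAndBars : ℕ → ℕ → ℕ
starsAndBars zero    zero    = 1
starsAndBars zero    (suc q) = 0
starsAndBars (suc c) zero    = starsAndBars c zero
starsAndBars (suc c) (suc q) = starsAndBars c (suc q) + starsAndBars (suc c) q

starsAndBars-C : ∀ c q → starsAndBars (suc c) q ≡ (q + c) C c
starsAndBars-C zero    zero    = refl
starsAndBars-C zero    (suc q) = starsAndBars-C zero q
starsAndBars-C (suc c) zero    = trans (starsAndBars-C c zero) (trans (nCn≡1 c) (sym (nCn≡1 (suc c))))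
starsAndBars-C (suc c) (suc q) = begin
  starsAndBars (suc c) (suc q) + starsAndBars (suc (suc c)) q ≡⟨ cong₂ _+_ (starsAndBars-C c (suc q)) (starsAndBars-C (suc c) q) ⟩
  (suc q + c) C c + (q + suc c) C suc c                       ≡⟨ cong (λ e → e C c + (q + suc c) C suc c) (sym (+-suc q c)) ⟩
  (q + suc c) C c + (q + suc c) C suc c                       ≡⟨ nCk+nC[k+1]≡[n+1]C[k+1] (q + suc c) c ⟩
  (suc q + suc c) C suc c                                     ∎
  where open ≡-Reasoning

module _ (p : ℕ) where

  private
    w : ℕ
    w = suc p

    Sol : ℕ → ℕ → Set
    Sol c n = SolutionsOf (replicate c w) n

    split-first : ∀ c n → Sol (suc c) (w + n) ↔ (Sol c (w + n) ⊎ Sol (suc c) n)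
    split-first c n = mk↔ₛ′ f g f∘g g∘f
      where
      shift : ∀ a s → w * suc a + s ≡ w + (w * a + s)
      shift a s = trans (cong (_+ s) (*-suc w a)) (+-assoc w (w * a) s)
      f : Sol (suc c) (w + n) → Sol c (w + n) ⊎ Sol (suc c) n
      f (zero  ∷ x , eq) = inj₁ (x , trans (sym (cong (_+ weightedSum (replicate c w) (toList x)) (*-zeroʳ w))) eq)
      f (suc a ∷ x , eq) = inj₂ (a ∷ x , +-cancelˡ-≡ w _ _ (trans (sym (shift a _)) eq))
      g : Sol c (w + n) ⊎ Sol (suc c) n → Sol (suc c) (w + n)
      g (inj₁ (x , eq))     = zero ∷ x , trans (cong (_+ weightedSum (replicate c w) (toList x)) (*-zeroʳ w)) eq
      g (inj₂ (a ∷ x , eq)) = suc a ∷ x , trans (shift a _) (cong (w +_) eq)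
      f∘g : ∀ s → f (g s) ≡ s
      f∘g (inj₁ s)           = cong inj₁ (solution-≡ {ws = replicate c w} refl)
      f∘g (inj₂ (a ∷ x , _)) = cong inj₂ (solution-≡ {ws = replicate (suc c) w} refl)
      g∘f : ∀ s → g (f s) ≡ s
      g∘f (zero  ∷ x , _) = solution-≡ {ws = replicate (suc c) w} refl
      g∘f (suc a ∷ x , _) = solution-≡ {ws = replicate (suc c) w} refl

    drop-first : ∀ c → Sol (suc c) 0 ↔ Sol c 0
    drop-first c = mk↔ₛ′ f g (λ s → solution-≡ {ws = replicate c w} refl) g∘f
      where
      f : Sol (suc c) 0 → Sol c 0
      f (a ∷ x , eq) = x , m+n≡0⇒n≡0 (w * a) eq
      g : Sol c 0 → Sol (suc c) 0
      g (x , eq) = zero ∷ x , trans (cong (_+ weightedSum (replicate c w) (toList x)) (*-zeroʳ w)) eq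
      g∘f : ∀ s → g (f s) ≡ s
      g∘f (zero  ∷ x , _) = solution-≡ {ws = replicate (suc c) w} refl

  starsAndBars-↔ : ∀ c q → Fin (starsAndBars c q) ↔ SolutionsOf (replicate c (suc p)) (q * suc p)
  starsAndBars-↔ zero    zero    = mk↔ₛ′ (λ _ → [] , refl) (λ _ → zero) (λ { ([] , _) → solution-≡ {ws = []} refl }) (λ { zero → refl })
  starsAndBars-↔ zero    (suc q) = mk↔ₛ′ (λ ()) (λ { (_ , ()) }) (λ { (_ , ()) }) (λ ())
  starsAndBars-↔ (suc c) zero    = ↔-trans (starsAndBars-↔ c zero) (↔-sym (drop-first c))
  starsAndBars-↔ (suc c) (suc q) = ↔-trans Finₚ.+↔⊎ (↔-trans
    (starsAndBars-↔ c (suc q) ⊎-↔ starsAndBars-↔ (suc c) q) (↔-sym (split-first c (q * w))))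

  ∣-weightedSum : ∀ c (x : Vec ℕ (length (replicate c (suc p)))) → suc p ∣ weightedSum (replicate c (suc p)) (toList x)
  ∣-weightedSum zero    []      = (suc p) ∣0
  ∣-weightedSum (suc c) (a ∷ x) = ∣m∣n⇒∣m+n (m∣m*n a) (∣-weightedSum c x)

-- The theorem for a fixed exponent, and its specialization to primes

module Main (k′ L : ℕ) (2+L≡2^k : 2 + L ≡ 2 ^ suc k′) where

  open Doubling k′ L 2+L≡2^k
  open Orbits double k′ double^k
  open NecklaceCount k′ L 2+L≡2^k
  open Bijection k′ L 2+L≡2^k

  private
    k : ℕ
    k = suc k′

    inDk? : ∀ d → Dec (d ∣ k × ¬ d ≡ 1)
    inDk? d = (d ∣? k) ×-dec ¬? (d ℕ.≟ 1)

  Dk-unique : Unique (Dk k)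
  Dk-unique = Uniqueₚ.filter⁺ inDk? (Uniqueₚ.map⁺ suc-injective (Uniqueₚ.upTo⁺ k))

  -- This accounts for the absence of 1 from `Dk`: only the two constant words are fixed by a
  -- rotation, and `Fin L` omits them.
  per≢1 : ∀ v → per v ≢ 1
  per≢1 v eq = double-≢ v (subst (λ e → iter double e v ≡ v) eq (iter-per v))

  per∈Dk : ∀ v → per v ∈ Dk k
  per∈Dk v = ∈ₚ.∈-filter⁺ inDk? (∈ₚ.∈-map⁺ suc (∈ₚ.∈-upTo⁺ (∣⇒≤ per∣k))) (per∣k , per≢1 v)
    where
    per∣k : per v ∣ k
    per∣k = per-∣ v k (double^k v)

  weights≡ : map per (reps (Dk k)) ≡ weights k
  weights≡ = map-per-reps N (Dk k) (All.map count (Allₚ.all-filter inDk? (map suc (List.upTo k))))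
    where
    count : ∀ {d} → d ∣ k × ¬ d ≡ 1 → # (isRepOfPeriod? d) ≡ N d
    count {zero}  (0∣k , _) = contradiction (0∣⇒≡0 0∣k) λ ()
    count {suc d} (d∣k , _) = sym (N-repsOfPeriod (suc d) d∣k)

  countGood↔Solutions : ∀ m → Fin (countGood k m) ↔ SolutionsOf (weights k) (suc m)
  countGood↔Solutions m = countGood-↔ (subst OrbitIndexing weights≡ (orbitIndexing (Dk k) Dk-unique per∈Dk)) m

  -- A period divides the prime k and is not 1, so all `L` points lie on orbits of size k.
  N-prime : Prime k → N k * k ≡ L
  N-prime pk = begin
    N k * k                     ≡⟨ cong (_* k) (N-repsOfPeriod k ∣-refl) ⟩
    # (isRepOfPeriod? k) * k    ≡⟨ sym (period-count k) ⟩
    # (λ v → per v ℕ.≟ k)       ≡⟨ #-all (λ v → per v ℕ.≟ k) per≡k ⟩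
    L                           ∎
    where
    open ≡-Reasoning
    per≡k : ∀ v → per v ≡ k
    per≡k v = [ (λ eq → contradiction eq (per≢1 v)) , id ]′ (prime⇒irreducible pk (per-∣ v k (double^k v)))

  weights-prime : Prime k → weights k ≡ replicate (N k) k
  weights-prime pk = trans (cong (concatMap (λ d → replicate (N d) d)) Dk≡) (Listₚ.++-identityʳ _)
    where
    below : ∀ {d} → d ∈ map suc (List.upTo k′) → ¬ (d ∣ k × ¬ d ≡ 1)
    below d∈ (d∣k , d≢1) with ∈ₚ.∈-map⁻ suc d∈
    ... | e , e∈ , refl with prime⇒irreducible pk d∣k
    ...   | inj₁ d≡1  = d≢1 d≡1
    ...   | inj₂ refl = <-irrefl refl (∈ₚ.∈-upTo⁻ e∈)
    Dk≡ : Dk k ≡ k ∷ []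
    Dk≡ = begin
      filter inDk? (map suc (List.upTo k))                              ≡⟨ cong (filter inDk? ∘ map suc) (sym (Listₚ.upTo-∷ʳ k′)) ⟩
      filter inDk? (map suc (List.upTo k′ ++ k′ ∷ []))                  ≡⟨ cong (filter inDk?) (Listₚ.map-++ suc (List.upTo k′) (k′ ∷ [])) ⟩
      filter inDk? (map suc (List.upTo k′) ++ k ∷ [])                   ≡⟨ Listₚ.filter-++ inDk? (map suc (List.upTo k′)) (k ∷ []) ⟩
      filter inDk? (map suc (List.upTo k′)) ++ filter inDk? (k ∷ [])    ≡⟨ cong₂ _++_
        (Listₚ.filter-none inDk? (All.tabulate below))
        (Listₚ.filter-accept inDk? {xs = []} (∣-refl , λ k≡1 → ¬prime[1] (subst Prime k≡1 pk))) ⟩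
      k ∷ []                                                            ∎
      where open ≡-Reasoning

  countGood↔replicate : Prime k → ∀ m → Fin (countGood k m) ↔ SolutionsOf (replicate (N k) k) (suc m)
  countGood↔replicate pk m = subst (λ ws → Fin (countGood k m) ↔ SolutionsOf ws (suc m)) (weights-prime pk) (countGood↔Solutions m)

  countGood-multiple : Prime k → 1 ≤ L → ∀ m q → suc m ≡ q * k → countGood k m ≡ (q + N k ∸ 1) C (N k ∸ 1)
  countGood-multiple pk 1≤L m q m≡ with N k in Nk≡
  -- `N k` is nonzero because `N k * k` equals `L`, which is positive; hence `N k ∸ 1` is a true
  -- predecessor.
  ... | zero  = contradiction (trans (sym (N-prime pk)) (cong (_* k) Nk≡)) (>⇒≢ 1≤L)
  ... | suc c = trans
    (Perm.↔⇒≡ (↔-trans (subst₂ (λ b n → Fin (countGood k m) ↔ SolutionsOf (replicate b k) n) Nk≡ m≡ (countGood↔replicate pk m))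
      (↔-sym (starsAndBars-↔ k′ (suc c) q))))
    (trans (starsAndBars-C c q) (cong (λ e → (e ∸ 1) C c) (sym (+-suc q c))))

  countGood-nonMultiple : Prime k → ∀ m → ¬ (k ∣ suc m) → countGood k m ≡ 0
  countGood-nonMultiple pk m k∤ = Perm.↔⇒≡ (↔-trans (countGood↔replicate pk m) (mk↔ₛ′ none (λ ()) (λ ()) (⊥-elim ∘ absurd)))
    where
    absurd : ¬ SolutionsOf (replicate (N k) k) (suc m)
    absurd (x , eq) = k∤ (subst (k ∣_) eq (∣-weightedSum k′ (N k) x))
    none : SolutionsOf (replicate (N k) k) (suc m) → Fin 0
    none = ⊥-elim ∘ absurd

2≤2^ : ∀ k → 2 ≤ 2 ^ suc k
2≤2^ k = *-monoʳ-≤ 2 (m^n>0 2 k)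

theorem1p4 : ((k : ℕ) → 2 ≤ k → (m : ℕ) → Fin (countGood k m) ↔ Solutions k (suc m))
    × ((p : ℕ) → Prime p
    → (N p * p ≡ 2 ^ p ∸ 2)
    × ((m q : ℕ) → suc m ≡ q * p → countGood p m ≡ (q + N p ∸ 1) C (N p ∸ 1))
    × ((m : ℕ) → ¬ (p ∣ suc m) → countGood p m ≡ 0))
theorem1p4 = general , primes
  where
  general : (k : ℕ) → 2 ≤ k → (m : ℕ) → Fin (countGood k m) ↔ Solutions k (suc m)
  general (suc k) _ = Main.countGood↔Solutions k (2 ^ suc k ∸ 2) (m+[n∸m]≡n (2≤2^ k))
  primes : (p : ℕ) → Prime p
    → (N p * p ≡ 2 ^ p ∸ 2)
    × ((m q : ℕ) → suc m ≡ q * p → countGood p m ≡ (q + N p ∸ 1) C (N p ∸ 1))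
    × ((m : ℕ) → ¬ (p ∣ suc m) → countGood p m ≡ 0)
  primes zero          pp = contradiction refl (ℕ.≢-nonZero⁻¹ 0 {{prime⇒nonZero pp}})
  primes (suc zero)    pp = contradiction pp ¬prime[1]
  primes (suc (suc p)) pp = N-prime pp , countGood-multiple pp 1≤L , countGood-nonMultiple pp
    where
    open Main (suc p) (2 ^ suc (suc p) ∸ 2) (m+[n∸m]≡n (2≤2^ (suc p)))
    1≤L : 1 ≤ 2 ^ suc (suc p) ∸ 2
    -- From 3 ≤ 4 ≤ 2 ^ (p + 2).
    1≤L = ∸-monoˡ-≤ 2 (≤-trans (s≤s (s≤s (s≤s z≤n))) (*-monoʳ-≤ 2 (2≤2^ p)))
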